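{- If $G$ is a connected unicyclic graph, then $Z(G) \le sdim(G)$.
   Context: A connected graph is unicyclic if it contains exactly one cycle (equivalently $|E(G)|=|V(G)|$). Zero forcing: color each vertex black or white, with $S$ the initial set of black vertices; the color-change rule turns a white vertex $u_2$ black if it is the only white neighbor of some black vertex. $S$ is a zero forcing set if repeated application eventually makes all vertices black; $Z(G)$ is the minimum size of a zero forcing set. A vertex $x$ strongly resolves $u,v$ if $u$ lies on some shortest $x$–$v$ path or $v$ lies on some shortest $x$–$u$ path; $W$ is a strong resolving set if every pair of distinct vertices is strongly resolved by some vertex of $W$; $sdim(G)$ is the minimum size of a strong resolving set. -}

module Defs where

open import Data.Nat using (ℕ; zero; suc; _+_; _≤_; _<_)
open import Data.Bool using (Bool; true; false; T)
open import Data.Fin using (Fin; toℕ)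
open import Data.Fin.Subset using (Subset; _∈_; ∣_∣)
open import Data.List using (List; []; _∷_; length; filter; concatMap; allFin)
open import Data.Product using (Σ; ∃; _×_; _,_)
open import Data.Sum using (_⊎_)
open import Relation.Binary.PropositionalEquality using (_≡_; _≢_)
open import Relation.Nullary using (¬_; Dec; yes; no)
open import Data.Bool.Properties using (T?)
open import Data.Nat.Properties using (_<?_)
open import Relation.Nullary.Decidable using (_×-dec_)

record Graph (n : ℕ) : Set where
  field
    adj     : Fin n → Fin n → Bool
    sym     : ∀ u v → T (adj u v) → T (adj v u)
    irrefl  : ∀ v → ¬ T (adj v v)
open Graph public

module _ {n : ℕ} (G : Graph n) where

  data Walk : Fin n → Fin n → Set where
    stay : ∀ x → Walk x x
    step : ∀ {x y z} → T (adj G x y) → Walk y z → Walk x z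

  len : ∀ {x z} → Walk x z → ℕ
  len (stay _)   = 0
  len (step _ w) = suc (len w)

  OnWalk : ∀ {x z} → Fin n → Walk x z → Set
  OnWalk u (stay x)           = u ≡ x
  OnWalk u (step {x = x} _ w) = u ≡ x ⊎ OnWalk u w

  Connected : Set
  Connected = ∀ u v → Walk u v

  edgeCount : ℕ
  edgeCount = length
    (filter (λ p → (toℕ (Data.Product.proj₁ p) <? toℕ (Data.Product.proj₂ p))
                   ×-dec T? (adj G (Data.Product.proj₁ p) (Data.Product.proj₂ p)))
      (concatMap (λ i → Data.List.map (λ j → (i , j)) (allFin n)) (allFin n)))

  Unicyclic : Set
  Unicyclic = Connected × (edgeCount ≡ n)

  -- a shortest x–v walk (automatically a path)
  Shortest : ∀ {x v} → Walk x v → Set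
  Shortest {x} {v} w = ∀ (w' : Walk x v) → len w ≤ len w'

  OnShortest : Fin n → Fin n → Fin n → Set
  OnShortest x u v = Σ (Walk x v) λ w → Shortest w × OnWalk u w

  StronglyResolves : Fin n → Fin n → Fin n → Set
  StronglyResolves x u v = OnShortest x u v ⊎ OnShortest x v u

  StrongResolvingSet : Subset n → Set
  StrongResolvingSet W =
    ∀ u v → u ≢ v → ∃ λ x → x ∈ W × StronglyResolves x u v

  -- vertices that eventually become black under the color-change rule
  -- starting from the black set S (least set closed under the rule)
  data Black (S : Subset n) : Fin n → Set where
    initial : ∀ {v} → v ∈ S → Black S v
    force   : ∀ {u v} → Black S u → T (adj G u v)
            → (∀ w → T (adj G u w) → w ≢ v → Black S w)
            → Black S v

  ZeroForcingSet : Subset n → Set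
  ZeroForcingSet S = ∀ v → Black S v

{-# OPTIONS --safe #-}

-- Deleting pendant vertices one after another leaves, by counting edges, a connected 2-regular
-- core, that is a cycle γ 0, …, γ (k − 1); the rest of the graph consists of trees hanging from
-- it.  A cycle vertex is bushy if it carries a tree and bare otherwise.
--
-- Lower bounds for a strong resolving set W come from mutually maximally distant pairs, each of
-- which meets W: two leaves; two bare antipodal cycle vertices; a bare cycle vertex and any leaf
-- of the tree at an antipode of it.
--
-- Conversely, a set containing all leaves except possibly ℓ blackens every tree vertex that is not
-- an ancestor of ℓ, hence every bushy vertex other than the root of ℓ.  Once two adjacent cycle
-- vertices are black, the cycle is blackened from both sides up to the root of ℓ, and finally
-- the path down to ℓ is.
--
-- W itself, or W with one element exchanged for another, is always zero forcing.  If W contains all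
-- leaves, trade a leaf (when two vertices are bushy) or a bare vertex for a neighbour of a black
-- cycle vertex.  If W misses ℓ, with root γ 0, the antipodes of γ 0 are bushy or in W; for odd k
-- these are two adjacent vertices, and for k = 2m one compares γ 1 with γ (m + 1).

module Submission where

open import Defs renaming (sym to adj-sym)
open import Data.Nat using (ℕ; zero; suc; _+_; _*_; _∸_; _≤_; _<_; z≤n; s≤s)
open import Data.Nat.Properties hiding (_≟_)
open import Data.Nat.DivMod using (_/_; _%_; m%n<n; m≡m%n+[m/n]*n)
open import Data.Nat.Induction using (<-wellFounded)
open import Data.Bool using (true; false; T; if_then_else_)
open import Data.Bool.Properties using (T?)
open import Data.Fin using (Fin; zero; suc; toℕ)
open import Data.Fin.Properties using (_≟_; toℕ-injective; toℕ<n; any?; all?; pigeonhole)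
open import Data.Fin.Subset using (Subset; _∈_; _∉_; ∣_∣; ⊤; _-_; _∪_; ⁅_⁆)
open import Data.Fin.Subset.Properties using (_∈?_; ∈⊤; x∈p∧x≢y⇒x∈p-y; x∈p⇒∣p-x∣<∣p∣; p─q⊆p; drop-there; x∈p∪q⁺; x∈⁅x⁆; ∣⁅x⁆∣≡1)
open import Data.List using (List; length; filter; concatMap; allFin; map; _++_; tabulate)
open import Data.List.Properties using (filter-++; length-++; map-tabulate)
open import Data.Vec using ([]; _∷_)
open import Data.Product using (Σ; ∃; _×_; _,_; proj₁; proj₂)
open import Data.Sum using (_⊎_; inj₁; inj₂; swap)
open import Data.Empty using (⊥-elim)
open import Function using (_∘_; id; case_of_)
open import Induction.WellFounded using (Acc; acc)
open import Relation.Binary.Definitions using (tri<; tri≈; tri>)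
open import Relation.Binary.PropositionalEquality using (_≡_; _≢_; refl; sym; trans; cong; cong₂; subst; module ≡-Reasoning)
open import Relation.Nullary using (¬_; Dec; yes; no; does; contradiction)
open import Relation.Nullary.Decidable using (_×-dec_; _→-dec_; ¬?; decidable-stable)
open import Algebra.Properties.CommutativeMonoid.Sum +-0-commutativeMonoid using (sum; ∑-distrib-+; ∑-comm; sum-cong-≗)

-- Indicators and finite sums.

𝟙 : {A : Set} → Dec A → ℕ
𝟙 d = if does d then 1 else 0

𝟙-yes : {A : Set} (d : Dec A) → A → 𝟙 d ≡ 1
𝟙-yes (yes _) _ = refl
𝟙-yes (no ¬a) a = contradiction a ¬a

𝟙-no : {A : Set} (d : Dec A) → ¬ A → 𝟙 d ≡ 0
𝟙-no (yes a) ¬a = contradiction a ¬a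
𝟙-no (no _)  _  = refl

𝟙-⇔ : {A B : Set} (a : Dec A) (b : Dec B) → (A → B) → (B → A) → 𝟙 a ≡ 𝟙 b
𝟙-⇔ (yes a) b f g = sym (𝟙-yes b (f a))
𝟙-⇔ (no ¬a) b f g = sym (𝟙-no b (¬a ∘ g))

𝟙-+-¬ : {A : Set} (a : Dec A) → 𝟙 a + 𝟙 (¬? a) ≡ 1
𝟙-+-¬ (yes _) = refl
𝟙-+-¬ (no _)  = refl

𝟙-⊎ : {A B Q : Set} (a : Dec A) (b : Dec B) (q : Dec Q) → (Q → A ⊎ B) → 𝟙 q ≤ 𝟙 a + 𝟙 b
𝟙-⊎ a b (no _)  _ = z≤n
𝟙-⊎ a b (yes q) f with f q
... | inj₁ x rewrite 𝟙-yes a x = s≤s z≤n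
... | inj₂ y rewrite 𝟙-yes b y = m≤n+m 1 (𝟙 a)

-- Used with `𝟙-cover` for counting: mutually exclusive reasons for `Q` give a pointwise bound, and
-- once a global count shows it to be tight, `Q` can hold for no other reason.
𝟙-exclusive : {A B C Q : Set} (a : Dec A) (b : Dec B) (c : Dec C) (q : Dec Q) →
  (A → Q) → (B → Q) → (C → Q) → (A → ¬ B) → (A → ¬ C) → (B → ¬ C) →
  𝟙 a + (𝟙 b + 𝟙 c) ≤ 𝟙 q
𝟙-exclusive (yes a) b c q aq _ _ ab ac _
  rewrite 𝟙-no b (ab a) | 𝟙-no c (ac a) | 𝟙-yes q (aq a) = ≤-refl
𝟙-exclusive (no _) (yes b) c q _ bq _ _ _ bc
  rewrite 𝟙-no c (bc b) | 𝟙-yes q (bq b) = ≤-refl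
𝟙-exclusive (no _) (no _) (yes c) q _ _ cq _ _ _ rewrite 𝟙-yes q (cq c) = ≤-refl
𝟙-exclusive (no _) (no _) (no _)  q _ _ _ _ _ _ = z≤n

𝟙-cover : {A B C Q : Set} (a : Dec A) (b : Dec B) (c : Dec C) (q : Dec Q) →
  𝟙 q ≤ 𝟙 a + (𝟙 b + 𝟙 c) → Q → A ⊎ B ⊎ C
𝟙-cover (yes a) _       _       _ _ _ = inj₁ a
𝟙-cover (no _)  (yes b) _       _ _ _ = inj₂ (inj₁ b)
𝟙-cover (no _)  (no _)  (yes c) _ _ _ = inj₂ (inj₂ c)
𝟙-cover (no _)  (no _)  (no _)  q le x rewrite 𝟙-yes q x = contradiction le λ ()

sum-mono : ∀ {n} {f g : Fin n → ℕ} → (∀ i → f i ≤ g i) → sum f ≤ sum g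
sum-mono {zero}  _ = z≤n
sum-mono {suc n} h = +-mono-≤ (h zero) (sum-mono (h ∘ suc))

-- Slack in a single term could not be made up by the others, which all go the same way.
sum-mono-tight : ∀ {n} {f g : Fin n → ℕ} → (∀ i → f i ≤ g i) → sum g ≤ sum f → ∀ i → g i ≤ f i
sum-mono-tight {f = f} {g} h e zero =
  +-cancelʳ-≤ (sum (f ∘ suc)) (g zero) (f zero)
    (≤-trans (+-monoʳ-≤ (g zero) (sum-mono (h ∘ suc))) e)
sum-mono-tight {f = f} {g} h e (suc i) =
  sum-mono-tight (h ∘ suc)
    (+-cancelˡ-≤ (f zero) (sum (g ∘ suc)) (sum (f ∘ suc))
      (≤-trans (+-monoˡ-≤ (sum (g ∘ suc)) (h zero)) e)) i

sum-zero : ∀ n → sum {n} (λ _ → 0) ≡ 0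
sum-zero zero    = refl
sum-zero (suc n) = sum-zero n

sum-one : ∀ n → sum {n} (λ _ → 1) ≡ n
sum-one zero    = refl
sum-one (suc n) = cong suc (sum-one n)

sum-≟ : ∀ {n} (c : Fin n) → sum (λ v → 𝟙 (v ≟ c)) ≡ 1
sum-≟ {suc n} zero    = cong suc (trans (sum-cong-≗ (λ i → 𝟙-no (suc i ≟ zero {n}) λ ())) (sum-zero n))
sum-≟ {suc n} (suc c) = trans (sum-cong-≗ (λ i → 𝟙-⇔ (suc i ≟ suc c) (i ≟ c) (λ { refl → refl }) (cong suc))) (sum-≟ c)

sum-×-≟ : ∀ {n} {A : Set} (a : Dec A) (c : Fin n) → sum (λ v → 𝟙 (a ×-dec (v ≟ c))) ≡ 𝟙 a
sum-×-≟     (yes a) c = trans (sum-cong-≗ (λ v → 𝟙-⇔ (yes a ×-dec (v ≟ c)) (v ≟ c) proj₂ (a ,_))) (sum-≟ c)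
sum-×-≟ {n} (no ¬a) c = trans (sum-cong-≗ (λ v → 𝟙-no (no ¬a ×-dec (v ≟ c)) (¬a ∘ proj₁))) (sum-zero n)

∑∑-mono-tight : ∀ {n} {f g : Fin n → Fin n → ℕ} → (∀ i j → f i j ≤ g i j) →
  sum (λ i → sum (g i)) ≤ sum (λ i → sum (f i)) → ∀ i j → g i j ≤ f i j
∑∑-mono-tight h e i = sum-mono-tight (h i) (sum-mono-tight (λ i → sum-mono (h i)) e i)

∑∑-distrib-+ : ∀ {n} (f g : Fin n → Fin n → ℕ) →
  sum (λ i → sum (λ j → f i j + g i j)) ≡ sum (λ i → sum (f i)) + sum (λ i → sum (g i))
∑∑-distrib-+ f g =
  trans (sum-cong-≗ (λ i → ∑-distrib-+ (f i) (g i))) (∑-distrib-+ (λ i → sum (f i)) (λ i → sum (g i)))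

-- Counting edges.

module _ {A : Set} {P : A → Set} (P? : ∀ x → Dec (P x)) where

  length-filter-tabulate : ∀ {n} (g : Fin n → A) →
    length (filter P? (tabulate g)) ≡ sum (λ j → 𝟙 (P? (g j)))
  length-filter-tabulate {zero}  g = refl
  length-filter-tabulate {suc n} g with P? (g zero)
  ... | yes _ = cong suc (length-filter-tabulate (g ∘ suc))
  ... | no  _ = length-filter-tabulate (g ∘ suc)

  length-filter-concatMap : ∀ {n} {B : Set} (g : Fin n → B) (f : B → List A) →
    length (filter P? (concatMap f (tabulate g))) ≡ sum (λ i → length (filter P? (f (g i))))
  length-filter-concatMap {zero}  g f = refl
  length-filter-concatMap {suc n} g f = begin
    length (filter P? (f (g zero) ++ concatMap f (tabulate (g ∘ suc))))
      ≡⟨ cong length (filter-++ P? (f (g zero)) _) ⟩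
    length (filter P? (f (g zero)) ++ filter P? (concatMap f (tabulate (g ∘ suc))))
      ≡⟨ length-++ (filter P? (f (g zero))) ⟩
    length (filter P? (f (g zero))) + length (filter P? (concatMap f (tabulate (g ∘ suc))))
      ≡⟨ cong (length (filter P? (f (g zero))) +_) (length-filter-concatMap (g ∘ suc) f) ⟩
    sum (λ i → length (filter P? (f (g i)))) ∎
    where open ≡-Reasoning

-- `edgeCount` lists only pairs with increasing indices; each adjacent ordered pair is such a pair
-- or the reverse of one, and transposing the double sum identifies the two counts.
handshake : ∀ {n} (G : Graph n) →
  sum (λ u → sum (λ v → 𝟙 (T? (adj G u v)))) ≡ edgeCount G + edgeCount G
handshake {n} G = begin
  sum (λ u → sum (λ v → a u v))
    ≡⟨ sum-cong-≗ (λ u → sum-cong-≗ (λ v → split u v)) ⟩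
  sum (λ u → sum (λ v → up u v + up v u))
    ≡⟨ ∑∑-distrib-+ up (λ u v → up v u) ⟩
  sum (λ u → sum (λ v → up u v)) + sum (λ u → sum (λ v → up v u))
    ≡⟨ cong (sum (λ u → sum (up u)) +_) (sym (∑-comm up)) ⟩
  sum (λ u → sum (up u)) + sum (λ u → sum (up u))
    ≡⟨ cong₂ _+_ (sym count) (sym count) ⟩
  edgeCount G + edgeCount G ∎
  where
  open ≡-Reasoning
  a up : Fin n → Fin n → ℕ
  a u v = 𝟙 (T? (adj G u v))
  Up? : (p : Fin n × Fin n) → Dec (toℕ (proj₁ p) < toℕ (proj₂ p) × T (adj G (proj₁ p) (proj₂ p)))
  Up? p = (toℕ (proj₁ p) <? toℕ (proj₂ p)) ×-dec T? (adj G (proj₁ p) (proj₂ p))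
  up u v = 𝟙 (Up? (u , v))
  count : edgeCount G ≡ sum (λ u → sum (up u))
  count = trans (length-filter-concatMap Up? id (λ i → map (λ j → (i , j)) (allFin n)))
    (sum-cong-≗ (λ i → trans (cong (length ∘ filter Up?) (map-tabulate id (λ j → (i , j))))
                             (length-filter-tabulate Up? (λ j → (i , j)))))
  split : ∀ u v → a u v ≡ up u v + up v u
  split u v with <-cmp (toℕ u) (toℕ v)
  ... | tri< lt _ ngt = sym (begin
    up u v + up v u ≡⟨ cong (up u v +_) (𝟙-no (Up? (v , u)) (ngt ∘ proj₁)) ⟩
    up u v + 0      ≡⟨ +-identityʳ _ ⟩
    up u v          ≡⟨ 𝟙-⇔ (Up? (u , v)) (T? (adj G u v)) proj₂ (lt ,_) ⟩
    a u v           ∎)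
  ... | tri> nlt _ gt = sym (begin
    up u v + up v u ≡⟨ cong (_+ up v u) (𝟙-no (Up? (u , v)) (nlt ∘ proj₁)) ⟩
    up v u          ≡⟨ 𝟙-⇔ (Up? (v , u)) (T? (adj G u v)) (adj-sym G v u ∘ proj₂) ((gt ,_) ∘ adj-sym G u v) ⟩
    a u v           ∎)
  ... | tri≈ nlt eq ngt with refl ← toℕ-injective eq = begin
    a u u           ≡⟨ 𝟙-no (T? (adj G u u)) (irrefl G u) ⟩
    0               ≡⟨ cong₂ _+_ (sym (𝟙-no (Up? (u , u)) (nlt ∘ proj₁))) (sym (𝟙-no (Up? (u , u)) (nlt ∘ proj₁))) ⟩
    up u u + up u u ∎

-- Replacing one element of a subset.

x∉p-x : ∀ {n} (p : Subset n) (x : Fin n) → x ∉ p - x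
x∉p-x (_ ∷ p) (suc x) x∈ = x∉p-x p x (drop-there x∈)
x∉p-x (true  ∷ p) zero ()
x∉p-x (false ∷ p) zero ()

x∈p-y⇒x≢y : ∀ {n} {p : Subset n} {x y : Fin n} → x ∈ p - y → x ≢ y
x∈p-y⇒x≢y {p = p} {x} x∈ refl = x∉p-x p x x∈

x∈p-y⇒x∈p : ∀ {n} {p : Subset n} {x y : Fin n} → x ∈ p - y → x ∈ p
x∈p-y⇒x∈p {p = p} {y = y} = p─q⊆p p ⁅ y ⁆

x∉p-y⇒x≡y⊎x∉p : ∀ {n} {p : Subset n} {x y : Fin n} → x ∉ p - y → x ≡ y ⊎ x ∉ p
x∉p-y⇒x≡y⊎x∉p {x = x} {y} x∉ with x ≟ y
... | yes x≡y = inj₁ x≡y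
... | no  x≢y = inj₂ λ x∈p → x∉ (x∈p∧x≢y⇒x∈p-y x∈p x≢y)

module _ {n : ℕ} {B : Set} where

  update : (Fin n → B) → Fin n → B → Fin n → B
  update f v b x = if does (x ≟ v) then b else f x

  update-≡ : ∀ f v b → update f v b v ≡ b
  update-≡ f v b with v ≟ v
  ... | yes _   = refl
  ... | no  v≢v = contradiction refl v≢v

  update-≢ : ∀ f {v} b {x} → x ≢ v → update f v b x ≡ f x
  update-≢ f {v} b {x} x≢v with x ≟ v
  ... | yes x≡v = contradiction x≡v x≢v
  ... | no  _   = refl

∣p∪q∣≤∣p∣+∣q∣ : ∀ {n} (p q : Subset n) → ∣ p ∪ q ∣ ≤ ∣ p ∣ + ∣ q ∣
∣p∪q∣≤∣p∣+∣q∣ []          []          = z≤n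
∣p∪q∣≤∣p∣+∣q∣ (false ∷ p) (false ∷ q) = ∣p∪q∣≤∣p∣+∣q∣ p q
∣p∪q∣≤∣p∣+∣q∣ (true  ∷ p) (false ∷ q) = s≤s (∣p∪q∣≤∣p∣+∣q∣ p q)
∣p∪q∣≤∣p∣+∣q∣ (false ∷ p) (true  ∷ q) = ≤-trans (s≤s (∣p∪q∣≤∣p∣+∣q∣ p q)) (≤-reflexive (sym (+-suc ∣ p ∣ ∣ q ∣)))
∣p∪q∣≤∣p∣+∣q∣ (true  ∷ p) (true  ∷ q) = s≤s (≤-trans (∣p∪q∣≤∣p∣+∣q∣ p q) (+-monoʳ-≤ ∣ p ∣ (n≤1+n ∣ q ∣)))

module _ {n : ℕ} (W : Subset n) {y : Fin n} (y∈W : y ∈ W) (x : Fin n) where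

  exchange : Subset n
  exchange = (W - y) ∪ ⁅ x ⁆

  x∈exchange : x ∈ exchange
  x∈exchange = x∈p∪q⁺ (inj₂ (x∈⁅x⁆ x))

  ∈exchange : ∀ {w} → w ∈ W → w ≢ y → w ∈ exchange
  ∈exchange w∈W w≢y = x∈p∪q⁺ (inj₁ (x∈p∧x≢y⇒x∈p-y w∈W w≢y))

  -- Only an inequality, because `x` may already lie in `W - y`.
  ∣exchange∣ : ∣ exchange ∣ ≤ ∣ W ∣
  ∣exchange∣ = begin
    ∣ exchange ∣              ≤⟨ ∣p∪q∣≤∣p∣+∣q∣ (W - y) ⁅ x ⁆ ⟩
    ∣ W - y ∣ + ∣ ⁅ x ⁆ ∣     ≡⟨ cong (∣ W - y ∣ +_) (∣⁅x⁆∣≡1 x) ⟩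
    ∣ W - y ∣ + 1             ≡⟨ +-comm ∣ W - y ∣ 1 ⟩
    suc ∣ W - y ∣             ≤⟨ x∈p⇒∣p-x∣<∣p∣ y∈W ⟩
    ∣ W ∣                     ∎
    where open ≤-Reasoning

-- Halving the length of the cycle.

data Half (k m : ℕ) : Set where
  even : k ≡ m + m → Half k m
  odd  : k ≡ suc (m + m) → Half k m

half : ∀ k → ∃ (Half k)
half zero    = 0 , even refl
half (suc k) with half k
... | m , even refl = m , odd refl
... | m , odd refl  = suc m , even (cong suc (sym (+-suc m m)))

module _ {k m : ℕ} where

  -- Together with `half-lower` this makes index `m` an antipode of index 0 on a cycle of length
  -- `k`, in the form required by `bare-extremal`.
  half-upper : Half k m → k ≤ suc (m + m)
  half-upper (even refl) = n≤1+n _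
  half-upper (odd refl)  = ≤-refl

  half-lower : Half k m → m + m ≤ suc k
  half-lower (even refl) = n≤1+n _
  half-lower (odd refl)  = m≤n⇒m≤1+n (n≤1+n _)

half-positive : ∀ {k m} → 3 ≤ k → Half k m → 0 < m
half-positive {m = zero}  ()       (even refl)
half-positive {m = zero}  (s≤s ()) (odd refl)
half-positive {m = suc m} _        _ = s≤s z≤n

half-even : ∀ {m} → 3 ≤ m + m → 1 < m
half-even {suc zero}    (s≤s (s≤s ()))
half-even {suc (suc m)} _ = s≤s (s≤s z≤n)

1+half< : ∀ {k m} → 3 ≤ k → Half k m → suc m < k
1+half< {m = m} 3≤k (even refl) = +-monoˡ-< m (half-even 3≤k)
1+half< {m = m} 3≤k h@(odd refl) = s≤s (+-monoˡ-< m (half-positive 3≤k h))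

-- Pruning pendant vertices.

module _ {n : ℕ} (G : Graph n) where

  infix 4 _~_
  _~_ : Fin n → Fin n → Set
  u ~ v = T (adj G u v)

  ~-sym : ∀ {u v} → u ~ v → v ~ u
  ~-sym = adj-sym G _ _

  ~⇒≢ : ∀ {u v} → u ~ v → u ≢ v
  ~⇒≢ u~u refl = irrefl G _ u~u

  -- `U` is what remains of the vertex set. `rank` grows towards the core, so recursion on `rank`
  -- runs down the trees and recursion on `height ∸ rank` runs up to the core. The values of
  -- `parent` on `U` are arbitrary.
  record Pruning (U : Subset n) : Set where
    field
      parent      : Fin n → Fin n
      root        : Fin n → Fin n
      rank        : Fin n → ℕ
      height      : ℕ
      parent-adj  : ∀ {v} → v ∉ U → v ~ parent v
      neighbour   : ∀ {v w} → v ∉ U → v ~ w → w ≡ parent v ⊎ (w ∉ U × parent w ≡ v)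
      root∈U      : ∀ v → root v ∈ U
      root-core   : ∀ {v} → v ∈ U → root v ≡ v
      root-parent : ∀ {v} → v ∉ U → root (parent v) ≡ root v
      rank-parent : ∀ {v} → v ∉ U → rank v < rank (parent v)
      rank≤height : ∀ v → rank v ≤ height
      rank-core   : ∀ {v} → v ∈ U → rank v ≡ height

    neighbour-core : ∀ {u w} → u ∈ U → w ∉ U → u ~ w → parent w ≡ u
    neighbour-core u∈U w∉U u~w with neighbour w∉U (~-sym u~w)
    ... | inj₁ u≡pw      = sym u≡pw
    ... | inj₂ (u∉U , _) = contradiction u∈U u∉U

    -- An edge with an end outside the core joins a vertex to its parent, and these share a root.
    root-edge : ∀ {x y} → x ~ y → root x ≡ root y ⊎ (x ∈ U × y ∈ U)
    root-edge {x} {y} x~y with x ∈? U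
    ... | no x∉U with neighbour x∉U x~y
    ...   | inj₁ refl         = inj₁ (sym (root-parent x∉U))
    ...   | inj₂ (y∉U , refl) = inj₁ (root-parent y∉U)
    root-edge {x} {y} x~y | yes x∈U with y ∈? U
    ...   | yes y∈U = inj₂ (x∈U , y∈U)
    ...   | no  y∉U = inj₁ (trans (cong root (sym (neighbour-core x∈U y∉U x~y))) (root-parent y∉U))

    core-neighbour : ∀ {u v} → Walk G u v → root u ≢ root v → ∃ λ w → w ∈ U × root u ~ w
    core-neighbour (stay _) ne = contradiction refl ne
    core-neighbour (step {x} {y} {v} x~y p) ne with root-edge x~y
    ... | inj₂ (x∈U , y∈U) = y , y∈U , subst (_~ y) (sym (root-core x∈U)) x~y
    ... | inj₁ eq rewrite eq = core-neighbour p ne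

  trivialPruning : Pruning ⊤
  trivialPruning = record
    { parent = id ; root = id ; rank = λ _ → 0 ; height = 0
    ; parent-adj  = contradiction ∈⊤
    ; neighbour   = contradiction ∈⊤
    ; root∈U      = λ _ → ∈⊤
    ; root-core   = λ _ → refl
    ; root-parent = contradiction ∈⊤
    ; rank-parent = contradiction ∈⊤
    ; rank≤height = λ _ → z≤n
    ; rank-core   = λ _ → refl
    }

  Pendant : Subset n → Fin n → Fin n → Set
  Pendant U v q = v ∈ U × q ∈ U × v ~ q × (∀ w → w ∈ U → v ~ w → w ≡ q)

  -- `v` becomes a child of `q`, and the trees rooted at `v` are handed over to `q`. Raising the
  -- rank of all remaining core vertices to `suc height` puts `q` above `v`, whose rank is at most
  -- `height`.
  removePendant : ∀ {U v q} → Pendant U v q → Pruning U → Pruning (U - v)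
  removePendant {U} {v} {q} (v∈U , q∈U , v~q , only) P = record
    { parent = parent′ ; root = root′ ; rank = rank′ ; height = suc height
    ; parent-adj  = parent-adj′
    ; neighbour   = neighbour′
    ; root∈U      = root∈U′
    ; root-core   = λ x∈ → trans (collapse-≢ (subst (_≢ v) (sym (root-core (x∈p-y⇒x∈p x∈))) (x∈p-y⇒x≢y x∈)))
                                 (root-core (x∈p-y⇒x∈p x∈))
    ; root-parent = root-parent′
    ; rank-parent = rank-parent′
    ; rank≤height = rank≤height′
    ; rank-core   = rank′-core
    }
    where
    open Pruning P
    q≢v : q ≢ v
    q≢v = ~⇒≢ (~-sym v~q)
    q∈U′ : q ∈ U - v
    q∈U′ = x∈p∧x≢y⇒x∈p-y q∈U q≢v
    ∉U⇒≢v : ∀ {x} → x ∉ U → x ≢ v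
    ∉U⇒≢v x∉U refl = x∉U v∈U
    ∉U⇒∉U′ : ∀ {x} → x ∉ U → x ∉ U - v
    ∉U⇒∉U′ x∉U = x∉U ∘ x∈p-y⇒x∈p

    parent′ : Fin n → Fin n
    parent′ = update parent v q
    parent′-v : parent′ v ≡ q
    parent′-v = update-≡ parent v q
    parent′-old : ∀ {x} → x ∉ U → parent′ x ≡ parent x
    parent′-old x∉U = update-≢ parent q (∉U⇒≢v x∉U)

    collapse root′ : Fin n → Fin n
    collapse = update id v q
    root′ = collapse ∘ root
    collapse-≢ : ∀ {x} → x ≢ v → collapse x ≡ x
    collapse-≢ = update-≢ id q

    rank′ : Fin n → ℕ
    rank′ x = if does (x ∈? U - v) then suc height else rank x
    rank′-core : ∀ {x} → x ∈ U - v → rank′ x ≡ suc height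
    rank′-core {x} x∈ with x ∈? U - v
    ... | yes _  = refl
    ... | no  x∉ = contradiction x∈ x∉
    rank′-old : ∀ {x} → x ∉ U - v → rank′ x ≡ rank x
    rank′-old {x} x∉ with x ∈? U - v
    ... | yes x∈ = contradiction x∈ x∉
    ... | no  _  = refl
    rank≤rank′ : ∀ x → rank x ≤ rank′ x
    rank≤rank′ x with x ∈? U - v
    ... | yes _ = m≤n⇒m≤1+n (rank≤height x)
    ... | no  _ = ≤-refl
    rank≤height′ : ∀ x → rank′ x ≤ suc height
    rank≤height′ x with x ∈? U - v
    ... | yes _ = ≤-refl
    ... | no  _ = m≤n⇒m≤1+n (rank≤height x)

    parent-adj′ : ∀ {x} → x ∉ U - v → x ~ parent′ x
    parent-adj′ x∉ with x∉p-y⇒x≡y⊎x∉p x∉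
    ... | inj₁ refl = subst (v ~_) (sym parent′-v) v~q
    ... | inj₂ x∉U  = subst (_ ~_) (sym (parent′-old x∉U)) (parent-adj x∉U)

    neighbour′ : ∀ {x w} → x ∉ U - v → x ~ w → w ≡ parent′ x ⊎ (w ∉ U - v × parent′ w ≡ x)
    neighbour′ {x} {w} x∉ x~w with x∉p-y⇒x≡y⊎x∉p x∉
    ... | inj₂ x∉U with neighbour x∉U x~w
    ...   | inj₁ w≡         = inj₁ (trans w≡ (sym (parent′-old x∉U)))
    ...   | inj₂ (w∉U , pw) = inj₂ (∉U⇒∉U′ w∉U , trans (parent′-old w∉U) pw)
    -- The only neighbour of `v` in `U` is `q`, the new parent; those outside `U` were already its
    -- children.
    neighbour′ {x} {w} x∉ v~w | inj₁ refl with w ∈? U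
    ...   | yes w∈U = inj₁ (trans (only w w∈U v~w) (sym parent′-v))
    ...   | no  w∉U = inj₂ (∉U⇒∉U′ w∉U , trans (parent′-old w∉U) (neighbour-core v∈U w∉U v~w))

    root∈U′ : ∀ x → root′ x ∈ U - v
    root∈U′ x with root x ≟ v
    ... | yes _   = q∈U′
    ... | no  r≢v = x∈p∧x≢y⇒x∈p-y (root∈U x) r≢v

    root-parent′ : ∀ {x} → x ∉ U - v → root′ (parent′ x) ≡ root′ x
    root-parent′ x∉ with x∉p-y⇒x≡y⊎x∉p x∉
    ... | inj₂ x∉U  = trans (cong root′ (parent′-old x∉U)) (cong collapse (root-parent x∉U))
    ... | inj₁ refl = begin
      root′ (parent′ v) ≡⟨ cong root′ parent′-v ⟩
      collapse (root q) ≡⟨ cong collapse (root-core q∈U) ⟩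
      collapse q        ≡⟨ collapse-≢ q≢v ⟩
      q                 ≡⟨ update-≡ id v q ⟨
      collapse v        ≡⟨ cong collapse (root-core v∈U) ⟨
      root′ v           ∎
      where open ≡-Reasoning

    rank-parent′ : ∀ {x} → x ∉ U - v → rank′ x < rank′ (parent′ x)
    rank-parent′ {x} x∉ rewrite rank′-old x∉ with x∉p-y⇒x≡y⊎x∉p x∉
    ... | inj₂ x∉U rewrite parent′-old x∉U = <-≤-trans (rank-parent x∉U) (rank≤rank′ _)
    ... | inj₁ refl rewrite parent′-v | rank′-core q∈U′ = s≤s (rank≤height v)

  pendant? : ∀ U → Dec (∃ λ v → ∃ λ q → Pendant U v q)
  pendant? U = any? λ v → any? λ q → (v ∈? U) ×-dec (q ∈? U) ×-dec T? (adj G v q) ×-dec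
    all? λ w → (w ∈? U) →-dec T? (adj G v w) →-dec (w ≟ q)

  pruned : ∃ λ U → Pruning U × (∀ v q → ¬ Pendant U v q)
  pruned = go ⊤ (<-wellFounded _) trivialPruning
    where
    go : ∀ U → Acc _<_ ∣ U ∣ → Pruning U → ∃ λ U → Pruning U × (∀ v q → ¬ Pendant U v q)
    go U (acc rec) P with pendant? U
    ... | yes (v , q , pd) = go (U - v) (rec (x∈p⇒∣p-x∣<∣p∣ (proj₁ pd))) (removePendant pd P)
    ... | no  none         = U , P , λ v q pd → none (v , q , pd)

  -- The core is 2-regular.

  record TwoRegular (U : Subset n) : Set where
    field
      -- The labels carry no orientation: `left (right u)` need not be `u`.
      left right : Fin n → Fin n
      left∈U     : ∀ {u} → u ∈ U → left u ∈ U
      right∈U    : ∀ {u} → u ∈ U → right u ∈ U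
      left-adj   : ∀ {u} → u ∈ U → u ~ left u
      right-adj  : ∀ {u} → u ∈ U → u ~ right u
      left≢right : ∀ {u} → u ∈ U → left u ≢ right u
      only       : ∀ {u w} → u ∈ U → w ∈ U → u ~ w → w ≡ left u ⊎ w ≡ right u

  module _ (conn : Connected G) (m≡n : edgeCount G ≡ n) where

    private
      total : sum (λ u → sum (λ v → 𝟙 (T? (adj G u v)))) ≡ n + n
      total = trans (handshake G) (cong₂ _+_ m≡n m≡n)

      -- A core reduced to one vertex leaves a tree, which has only n − 1 edges.
      core-not-singleton : ∀ {U} → Pruning U → ∀ u → ¬ (∀ x → x ∈ U → x ≡ u)
      core-not-singleton {U} P u single = <-irrefl refl (begin-strict
        n + n
          ≡⟨ total ⟨
        sum (λ x → sum (λ y → 𝟙 (T? (adj G x y))))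
          ≤⟨ sum-mono (λ x → sum-mono (λ y → 𝟙-⊎ (D? x y) (D? y x) (T? (adj G x y)) (cover x y))) ⟩
        sum (λ x → sum (λ y → 𝟙 (D? x y) + 𝟙 (D? y x)))
          ≡⟨ ∑∑-distrib-+ (λ x y → 𝟙 (D? x y)) (λ x y → 𝟙 (D? y x)) ⟩
        sum (λ x → sum (λ y → 𝟙 (D? x y))) + sum (λ x → sum (λ y → 𝟙 (D? y x)))
          ≡⟨ cong (sum (λ x → sum (λ y → 𝟙 (D? x y))) +_) (sym (∑-comm (λ x y → 𝟙 (D? x y)))) ⟩
        sum (λ x → sum (λ y → 𝟙 (D? x y))) + sum (λ x → sum (λ y → 𝟙 (D? x y)))
          ≡⟨ cong₂ _+_ inner inner ⟩
        M + M
          <⟨ +-mono-< M<n M<n ⟩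
        n + n ∎)
        where
        open ≤-Reasoning
        open Pruning P
        D? : ∀ x y → Dec ((¬ (x ≡ u)) × y ≡ parent x)
        D? x y = ¬? (x ≟ u) ×-dec (y ≟ parent x)
        M : ℕ
        M = sum (λ x → 𝟙 (¬? (x ≟ u)))
        inner : sum (λ x → sum (λ y → 𝟙 (D? x y))) ≡ M
        inner = sum-cong-≗ (λ x → sum-×-≟ (¬? (x ≟ u)) (parent x))
        M<n : M < n
        M<n = ≤-reflexive (begin-equality
          suc M                                            ≡⟨ cong (_+ M) (sum-≟ u) ⟨
          sum (λ x → 𝟙 (x ≟ u)) + M                        ≡⟨ ∑-distrib-+ (λ x → 𝟙 (x ≟ u)) (λ x → 𝟙 (¬? (x ≟ u))) ⟨
          sum (λ x → 𝟙 (x ≟ u) + 𝟙 (¬? (x ≟ u)))           ≡⟨ sum-cong-≗ (λ x → 𝟙-+-¬ (x ≟ u)) ⟩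
          sum {n} (λ _ → 1)                                ≡⟨ sum-one n ⟩
          n                                                ∎)
        u∈U : u ∈ U
        u∈U = subst (_∈ U) (single _ (root∈U u)) (root∈U u)
        ∉U : ∀ {x} → x ≢ u → x ∉ U
        ∉U x≢u x∈U = x≢u (single _ x∈U)
        ∉U⇒≢ : ∀ {x} → x ∉ U → x ≢ u
        ∉U⇒≢ x∉U refl = x∉U u∈U
        cover : ∀ x y → x ~ y → (x ≢ u × y ≡ parent x) ⊎ (y ≢ u × x ≡ parent y)
        cover x y x~y with x ≟ u
        ... | yes refl = inj₂ (y≢u , sym (neighbour-core u∈U (∉U y≢u) x~y))
          where
          y≢u : y ≢ u
          y≢u = ~⇒≢ (~-sym x~y)
        ... | no x≢u with neighbour (∉U x≢u) x~y
        ...   | inj₁ y≡         = inj₁ (x≢u , y≡)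
        ...   | inj₂ (y∉U , py) = inj₂ (∉U⇒≢ y∉U , sym py)

    -- Twice the number of edges is 2n; the ordered pairs (v, parent v), (parent v, v) for v outside
    -- the core and two ordered pairs for each core vertex already account for all of them.
    core-twoRegular : ∀ {U} → Pruning U → (∀ v q → ¬ Pendant U v q) → TwoRegular U
    core-twoRegular {U} P noPendant = record
      { left = left ; right = right
      ; left∈U     = proj₁ ∘ inside
      ; right∈U    = proj₁ ∘ proj₂ ∘ inside
      ; left-adj   = left-adj
      ; right-adj  = right-adj
      ; left≢right = left≢right
      ; only       = only
      }
      where
      open Pruning P
      -- A second core vertex has a different root, so the walk to it must use a core edge at `u`.
      firstNeighbour : ∀ u → u ∈ U → ∃ λ w → w ∈ U × u ~ w
      firstNeighbour u u∈U with any? (λ x → (x ∈? U) ×-dec ¬? (x ≟ u))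
      ... | no  none = ⊥-elim (core-not-singleton P u
        (λ x x∈U → decidable-stable (x ≟ u) (λ x≢u → none (x , x∈U , x≢u))))
      ... | yes (x , x∈U , x≢u) =
        subst (λ z → ∃ λ w → w ∈ U × z ~ w) (root-core u∈U)
          (core-neighbour (conn u x) (λ eq → x≢u (trans (sym (root-core x∈U)) (trans (sym eq) (root-core u∈U)))))

      secondNeighbour : ∀ {u q} → u ∈ U → q ∈ U → u ~ q → ∃ λ w → w ∈ U × u ~ w × q ≢ w
      secondNeighbour {u} {q} u∈U q∈U u~q with any? (λ w → (w ∈? U) ×-dec T? (adj G u w) ×-dec ¬? (q ≟ w))
      ... | yes (w , p) = w , p
      ... | no  none    = ⊥-elim (noPendant u q (u∈U , q∈U , u~q ,
        λ w w∈U u~w → sym (decidable-stable (q ≟ w) (λ q≢w → none (w , w∈U , u~w , q≢w)))))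

      choice : ∀ u → ∃ λ a → ∃ λ b →
        (u ∈ U → a ∈ U × b ∈ U × u ~ a × u ~ b × a ≢ b) × (u ∉ U → a ≡ parent u)
      choice u with u ∈? U
      -- Outside the core `left` is set to the parent, so that `A?` covers both kinds of pairs; the
      -- value `u` for `right` is a filler, as `B?` asks for `u ∈ U`.
      ... | no u∉U = parent u , u , (λ u∈U → contradiction u∈U u∉U) , (λ _ → refl)
      ... | yes u∈U with firstNeighbour u u∈U
      ...   | a , a∈U , u~a with secondNeighbour u∈U a∈U u~a
      ...     | b , b∈U , u~b , a≢b =
        a , b , (λ _ → a∈U , b∈U , u~a , u~b , a≢b) , contradiction u∈U

      left right : Fin n → Fin n
      left  u = proj₁ (choice u)
      right u = proj₁ (proj₂ (choice u))
      inside : ∀ {u} → u ∈ U → left u ∈ U × right u ∈ U × u ~ left u × u ~ right u × left u ≢ right u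
      inside = proj₁ (proj₂ (proj₂ (choice _)))
      outside : ∀ {u} → u ∉ U → left u ≡ parent u
      outside = proj₂ (proj₂ (proj₂ (choice _)))
      left-adj : ∀ {u} → u ∈ U → u ~ left u
      left-adj = proj₁ ∘ proj₂ ∘ proj₂ ∘ inside
      right-adj : ∀ {u} → u ∈ U → u ~ right u
      right-adj = proj₁ ∘ proj₂ ∘ proj₂ ∘ proj₂ ∘ inside
      left≢right : ∀ {u} → u ∈ U → left u ≢ right u
      left≢right = proj₂ ∘ proj₂ ∘ proj₂ ∘ proj₂ ∘ inside

      -- `A?` accounts for one pair per vertex, `B?` for one per core vertex and `C?` for one per
      -- vertex outside the core, hence for `2n` pairs in all.
      A? : ∀ u v → Dec (v ≡ left u)
      A? u v = v ≟ left u
      B? : ∀ u v → Dec (u ∈ U × v ≡ right u)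
      B? u v = (u ∈? U) ×-dec (v ≟ right u)
      C? : ∀ u v → Dec ((¬ (v ∈ U)) × u ≡ parent v)
      C? u v = ¬? (v ∈? U) ×-dec (u ≟ parent v)

      a⇒ : ∀ {u v} → Dec (u ∈ U) → v ≡ left u → u ~ v
      a⇒     (yes u∈U) refl = left-adj u∈U
      a⇒ {u} (no  u∉U) refl = subst (u ~_) (sym (outside u∉U)) (parent-adj u∉U)

      a-¬c : ∀ {u v} → Dec (u ∈ U) → v ≡ left u → ¬ (v ∉ U × u ≡ parent v)
      a-¬c         (yes u∈U) v≡ (v∉U , u≡) = v∉U (subst (_∈ U) (sym v≡) (proj₁ (inside u∈U)))
      -- Two vertices cannot be each other's parent, because of their ranks.
      a-¬c {u} {v} (no  u∉U) v≡ (v∉U , u≡) = <-asym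
        (subst (λ z → rank u < rank z) (sym (trans v≡ (outside u∉U))) (rank-parent u∉U))
        (subst (λ z → rank v < rank z) (sym u≡) (rank-parent v∉U))

      below : ∀ u v → 𝟙 (A? u v) + (𝟙 (B? u v) + 𝟙 (C? u v)) ≤ 𝟙 (T? (adj G u v))
      below u v = 𝟙-exclusive (A? u v) (B? u v) (C? u v) (T? (adj G u v))
        (a⇒ (u ∈? U))
        (λ { (u∈U , refl) → right-adj u∈U })
        (λ { (v∉U , refl) → ~-sym (parent-adj v∉U) })
        (λ { v≡ (u∈U , v≡′) → left≢right u∈U (trans (sym v≡) v≡′) })
        (a-¬c (u ∈? U))
        (λ { (u∈U , refl) (v∉U , _) → v∉U (proj₁ (proj₂ (inside u∈U))) })

      above : ∀ u v → 𝟙 (T? (adj G u v)) ≤ 𝟙 (A? u v) + (𝟙 (B? u v) + 𝟙 (C? u v))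
      above = ∑∑-mono-tight below (≤-reflexive (trans total (sym (begin
        sum (λ u → sum (λ v → 𝟙 (A? u v) + (𝟙 (B? u v) + 𝟙 (C? u v))))
          ≡⟨ ∑∑-distrib-+ (λ u v → 𝟙 (A? u v)) (λ u v → 𝟙 (B? u v) + 𝟙 (C? u v)) ⟩
        sum (λ u → sum (λ v → 𝟙 (A? u v))) + sum (λ u → sum (λ v → 𝟙 (B? u v) + 𝟙 (C? u v)))
          ≡⟨ cong₂ _+_ (trans (sum-cong-≗ (λ u → sum-≟ (left u))) (sum-one n))
                       (∑∑-distrib-+ (λ u v → 𝟙 (B? u v)) (λ u v → 𝟙 (C? u v))) ⟩
        n + (sum (λ u → sum (λ v → 𝟙 (B? u v))) + sum (λ u → sum (λ v → 𝟙 (C? u v))))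
          ≡⟨ cong (n +_) (cong₂ _+_
               (sum-cong-≗ (λ u → sum-×-≟ (u ∈? U) (right u)))
               (trans (∑-comm (λ u v → 𝟙 (C? u v))) (sum-cong-≗ (λ v → sum-×-≟ (¬? (v ∈? U)) (parent v))))) ⟩
        n + (sum (λ u → 𝟙 (u ∈? U)) + sum (λ v → 𝟙 (¬? (v ∈? U))))
          ≡⟨ cong (n +_) (sym (∑-distrib-+ (λ u → 𝟙 (u ∈? U)) (λ u → 𝟙 (¬? (u ∈? U))))) ⟩
        n + sum (λ u → 𝟙 (u ∈? U) + 𝟙 (¬? (u ∈? U)))
          ≡⟨ cong (n +_) (trans (sum-cong-≗ (λ u → 𝟙-+-¬ (u ∈? U))) (sum-one n)) ⟩
        n + n ∎))))
        where open ≡-Reasoning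

      only : ∀ {u w} → u ∈ U → w ∈ U → u ~ w → w ≡ left u ⊎ w ≡ right u
      only {u} {w} u∈U w∈U u~w with 𝟙-cover (A? u w) (B? u w) (C? u w) (T? (adj G u w)) (above u w) u~w
      ... | inj₁ w≡                    = inj₁ w≡
      ... | inj₂ (inj₁ (_ , w≡))       = inj₂ w≡
      ... | inj₂ (inj₂ (w∉U , _))      = contradiction w∈U w∉U

  -- The core is a cycle.

  record Cycle (U : Subset n) (k : ℕ) (γ : ℕ → Fin n) : Set where
    field
      3≤k       : 3 ≤ k
      γ∈U       : ∀ i → γ i ∈ U
      edge      : ∀ i → γ i ~ γ (suc i)
      -- Indices range over all of `ℕ` and wrap around here, so that a rotation is a mere shift of
      -- the index.
      periodic  : ∀ i → γ (i + k) ≡ γ i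
      injective : ∀ {i j} → i < k → j < k → γ i ≡ γ j → i ≡ j
      cover     : ∀ {v} → v ∈ U → ∃ λ i → i < k × γ i ≡ v
      around    : ∀ i {w} → w ∈ U → γ (suc i) ~ w → w ≡ γ i ⊎ w ≡ γ (suc (suc i))

    0<k : 0 < k
    0<k = ≤-trans (s≤s z≤n) 3≤k

    -- The window of distinct indices is moved from `0 … k − 1` to `1 … k`, with `γ k` in place of
    -- `γ 0`.
    distinct : ∀ {a b} → 0 < a → a < b → b ≤ k → γ a ≢ γ b
    distinct {a} {b} 0<a a<b b≤k eq with m≤n⇒m<n∨m≡n b≤k
    ... | inj₁ b<k  = <-irrefl (injective (<-trans a<b b<k) b<k eq) a<b
    ... | inj₂ refl = <-irrefl (sym (injective a<b 0<k (trans eq (periodic 0)))) 0<a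

    γ≢γ0 : ∀ {a} → 0 < a → a < k → γ a ≢ γ 0
    γ≢γ0 0<a a<k eq = distinct 0<a a<k ≤-refl (trans eq (sym (periodic 0)))

  shift1 : ∀ {U k γ} → Cycle U k γ → Cycle U k (γ ∘ suc)
  shift1 {U} {k} {γ} C = record
    { 3≤k = 3≤k
    ; γ∈U = γ∈U ∘ suc
    ; edge = edge ∘ suc
    ; periodic = periodic ∘ suc
    ; injective = inj
    ; cover = cov
    ; around = around ∘ suc
    }
    where
    open Cycle C
    inj : ∀ {i j} → i < k → j < k → γ (suc i) ≡ γ (suc j) → i ≡ j
    inj {i} {j} i<k j<k eq with <-cmp i j
    ... | tri≈ _ i≡j _ = i≡j
    ... | tri< i<j _ _ = contradiction eq (distinct (s≤s z≤n) (s≤s i<j) j<k)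
    ... | tri> _ _ j<i = contradiction (sym eq) (distinct (s≤s z≤n) (s≤s j<i) i<k)
    wrap : ∀ {k} → 3 ≤ k → γ k ≡ γ 0 → ∃ λ i → i < k × γ (suc i) ≡ γ 0
    wrap {suc k} _ eq = k , ≤-refl , eq
    cov : ∀ {v} → v ∈ U → ∃ λ i → i < k × γ (suc i) ≡ v
    cov v∈U with cover v∈U
    ... | suc i , i<k , eq   = i , <-trans (n<1+n i) i<k , eq
    -- `γ 0` is found at the other end of the period, as the successor of index `k − 1`.
    ... | zero  , _   , refl = wrap 3≤k (periodic 0)

  shift : ∀ {U k γ} s → Cycle U k γ → Cycle U k (λ i → γ (s + i))
  shift zero    C = C
  shift (suc s) C = shift s (shift1 C)

  rebase : ∀ {U k γ v} → Cycle U k γ → v ∈ U → ∃ λ γ′ → Cycle U k γ′ × γ′ 0 ≡ v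
  rebase {γ = γ} C v∈U with Cycle.cover C v∈U
  ... | s , _ , eq = (λ i → γ (s + i)) , shift s C , trans (cong γ (+-identityʳ s)) eq

  module _ {U : Subset n} (P : Pruning U) (R : TwoRegular U) (conn : Connected G) (start : Fin n) where
    open Pruning P
    open TwoRegular R

    private
      other : Fin n → Fin n → Fin n
      other u x = if does (x ≟ left u) then right u else left u

      other-spec : ∀ {u x} → u ∈ U → x ∈ U → u ~ x →
        other u x ∈ U × u ~ other u x × other u x ≢ x × (∀ {w} → w ∈ U → u ~ w → w ≡ x ⊎ w ≡ other u x)
      other-spec {u} {x} u∈U x∈U u~x with x ≟ left u
      ... | yes refl = right∈U u∈U , right-adj u∈U , left≢right u∈U ∘ sym , only u∈U
      ... | no  x≢l  with only u∈U x∈U u~x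
      ...   | inj₁ x≡l  = contradiction x≡l x≢l
      ...   | inj₂ refl = left∈U u∈U , left-adj u∈U , left≢right u∈U , λ w∈U u~w → swap (only u∈U w∈U u~w)

      -- The state is a directed edge, because the next core vertex depends on where the walk came
      -- from.
      dart : ℕ → Fin n × Fin n
      dart zero    = root start , left (root start)
      dart (suc i) = proj₂ (dart i) , other (proj₂ (dart i)) (proj₁ (dart i))

      γ : ℕ → Fin n
      γ i = proj₁ (dart i)

      dart-spec : ∀ i → γ i ∈ U × γ (suc i) ∈ U × γ i ~ γ (suc i)
      dart-spec zero    = root∈U start , left∈U (root∈U start) , left-adj (root∈U start)
      dart-spec (suc i) with dart-spec i
      ... | x∈U , y∈U , x~y with other-spec y∈U x∈U (~-sym x~y)
      ...   | z∈U , y~z , _ = y∈U , z∈U , y~z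

      around′ : ∀ i {w} → w ∈ U → γ (suc i) ~ w → w ≡ γ i ⊎ w ≡ γ (suc (suc i))
      around′ i with dart-spec i
      ... | x∈U , y∈U , x~y = proj₂ (proj₂ (proj₂ (other-spec y∈U x∈U (~-sym x~y))))

      no-return : ∀ i → γ (suc (suc i)) ≢ γ i
      no-return i with dart-spec i
      ... | x∈U , y∈U , x~y = proj₁ (proj₂ (proj₂ (other-spec y∈U x∈U (~-sym x~y))))

      edge′ : ∀ i → γ i ~ γ (suc i)
      edge′ = proj₂ ∘ proj₂ ∘ dart-spec

      Distinct : ℕ → Set
      Distinct m = ∀ {i j} → i < j → j < m → γ i ≢ γ j

      firstRepeat : ∀ m → Distinct m ⊎ (∃ λ k → Distinct k × ∃ λ i → i < k × γ i ≡ γ k)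
      firstRepeat zero = inj₁ λ _ ()
      firstRepeat (suc m) with firstRepeat m
      ... | inj₂ found = inj₂ found
      ... | inj₁ dist with anyUpTo? (λ i → γ i ≟ γ m) m
      ...   | yes hit = inj₂ (m , dist , hit)
      ...   | no  new = inj₁ λ i<j j<1+m eq → case m≤n⇒m<n∨m≡n (≤-pred j<1+m) of λ where
        (inj₁ j<m)  → dist i<j j<m eq
        (inj₂ refl) → new (_ , i<j , eq)

      repeat : ∃ λ k → Distinct k × ∃ λ i → i < k × γ i ≡ γ k
      repeat with firstRepeat (suc n)
      ... | inj₂ found = found
      ... | inj₁ dist with pigeonhole (n<1+n n) (γ ∘ toℕ)
      ...   | i , j , i<j , eq = ⊥-elim (dist i<j (toℕ<n j) eq)

      -- If the first repetition hit `γ (suc i)`, the vertex before it would be one of the two core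
      -- neighbours of `γ (suc i)`, giving an earlier repetition, a step back or a loop.
      repeat-at-0 : ∀ {k} → Distinct k → ∀ i → i < k → γ i ≡ γ k → γ 0 ≡ γ k
      repeat-at-0 dist zero _ eq = eq
      repeat-at-0 {suc k} dist (suc i) (s≤s i<k) eq
        with around′ i (proj₁ (dart-spec k)) (subst (_~ γ k) (sym eq) (~-sym (edge′ k)))
      ... | inj₁ same = contradiction (sym same) (dist i<k ≤-refl)
      ... | inj₂ same with <-cmp k (suc (suc i))
      ...   | tri> _ _ lt = contradiction (sym same) (dist lt ≤-refl)
      ...   | tri≈ _ refl _ = contradiction (sym eq) (no-return (suc i))
      ...   | tri< lt _ _ with ≤-antisym i<k (≤-pred lt)
      ...     | refl = contradiction eq (~⇒≢ (edge′ k))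

      period≥3 : ∀ {k} → 0 < k → γ 0 ≡ γ k → 3 ≤ k
      period≥3 {1} _ eq = contradiction eq (~⇒≢ (edge′ 0))
      period≥3 {2} _ eq = contradiction (sym eq) (no-return 0)
      period≥3 {suc (suc (suc _))} _ _ = s≤s (s≤s (s≤s z≤n))

      -- `γ 1` is a core neighbour of `γ k`; it is not `γ (k − 1)`, since `1 < k − 1`, so it is the
      -- next vertex.
      period-1 : ∀ {k} → Distinct k → 3 ≤ k → γ 0 ≡ γ k → γ (suc k) ≡ γ 1
      period-1 {suc k} dist (s≤s 2≤k) eq
        with around′ k (proj₁ (dart-spec 1)) (subst (_~ γ 1) eq (edge′ 0))
      ... | inj₁ same = contradiction same (dist 2≤k ≤-refl)
      ... | inj₂ same = sym same

    cycle : ∃ λ k → ∃ λ γ → Cycle U k γ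
    cycle with repeat
    ... | k , dist , i , i<k , γi≡γk = k , γ , record
      { 3≤k = 3≤k
      ; γ∈U = proj₁ ∘ dart-spec
      ; edge = edge′
      ; periodic = periodic
      ; injective = injective
      ; cover = λ {v} v∈U → let (j , eq) = reach (conn start v) (0 , refl) in
                            let (l , l<k , eq′) = reduce 3≤k periodic j in
                            l , l<k , trans eq′ (trans (sym eq) (root-core v∈U))
      ; around = around′
      }
      where
      γ0≡γk : γ 0 ≡ γ k
      γ0≡γk = repeat-at-0 dist i i<k γi≡γk
      3≤k : 3 ≤ k
      3≤k = period≥3 (≤-trans (s≤s z≤n) i<k) γ0≡γk
      -- Two consecutive vertices determine the next one, so the induction carries both.
      periodic₂ : ∀ i → γ (i + k) ≡ γ i × γ (suc (i + k)) ≡ γ (suc i)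
      periodic₂ zero    = sym γ0≡γk , period-1 dist 3≤k γ0≡γk
      periodic₂ (suc i) with periodic₂ i
      ... | eq , eq′ = eq′ , cong₂ other eq′ eq
      periodic : ∀ i → γ (i + k) ≡ γ i
      periodic = proj₁ ∘ periodic₂
      injective : ∀ {i j} → i < k → j < k → γ i ≡ γ j → i ≡ j
      injective {i} {j} i<k j<k eq with <-cmp i j
      ... | tri< i<j _ _ = contradiction eq (dist i<j j<k)
      ... | tri≈ _ i≡j _ = i≡j
      ... | tri> _ _ j<i = contradiction (sym eq) (dist j<i i<k)
      reduce : ∀ {k} → 3 ≤ k → (∀ i → γ (i + k) ≡ γ i) → ∀ i → ∃ λ j → j < k × γ j ≡ γ i
      reduce {k@(suc _)} _ per i = i % k , m%n<n i k , sym (trans (cong γ (m≡m%n+[m/n]*n i k)) (multiple (i / k) (i % k)))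
        where
        multiple : ∀ q r → γ (r + q * k) ≡ γ r
        multiple zero    r = cong γ (+-identityʳ r)
        multiple (suc q) r = trans (cong γ (trans (cong (r +_) (+-comm k (q * k))) (sym (+-assoc r (q * k) k))))
                                   (trans (per (r + q * k)) (multiple q r))
      predecessor : ∀ {k} → 3 ≤ k → (∀ i → γ (i + k) ≡ γ i) → ∀ i → ∃ λ j → γ (suc j) ≡ γ i
      predecessor {suc k} _ per i = i + k , trans (cong γ (sym (+-suc i k))) (per i)
      -- The root of the current vertex stays on `γ` along any walk; with connectivity this reaches
      -- every core vertex.
      reach : ∀ {x v} → Walk G x v → (∃ λ i → root x ≡ γ i) → ∃ λ i → root v ≡ γ i
      reach (stay _) hit = hit
      reach (step x~y p) (i , eq) with root-edge x~y
      ... | inj₁ same = reach p (i , trans (sym same) eq)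
      ... | inj₂ (x∈U , y∈U) with predecessor 3≤k periodic i
      ...   | j , eq′ with around′ j y∈U (subst (_~ _) (trans (sym (root-core x∈U)) (trans eq (sym eq′))) x~y)
      ...     | inj₁ y≡ = reach p (j , trans (root-core y∈U) y≡)
      ...     | inj₂ y≡ = reach p (suc (suc j) , trans (root-core y∈U) y≡)

  -- Walks and extremal pairs.

  _++ʷ_ : ∀ {x y z} → Walk G x y → Walk G y z → Walk G x z
  stay _   ++ʷ q = q
  step e p ++ʷ q = step e (p ++ʷ q)

  len-++ʷ : ∀ {x y z} (p : Walk G x y) (q : Walk G y z) → len G (p ++ʷ q) ≡ len G p + len G q
  len-++ʷ (stay _)   q = refl
  len-++ʷ (step _ p) q = cong suc (len-++ʷ p q)

  -- Equivalently, no neighbour of u is farther from v than u.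
  Extremal : Fin n → Fin n → Set
  Extremal u v = ∀ {x} → OnShortest G x u v → x ≡ u

  -- A resolving vertex has `u` or `v` on a shortest path to the other one, and extremality makes it
  -- equal to that vertex.
  extremal-pair : ∀ {W} → StrongResolvingSet G W → ∀ {u v} → u ≢ v → Extremal u v → Extremal v u → u ∈ W ⊎ v ∈ W
  extremal-pair res {u} {v} u≢v ext ext′ with res u v u≢v
  ... | x , x∈W , inj₁ on with refl ← ext on  = inj₁ x∈W
  ... | x , x∈W , inj₂ on with refl ← ext′ on = inj₂ x∈W

  -- `y` is the vertex preceding `u`. That it is farther from `v` is stated against all walks, in
  -- place of a distance function.
  before : ∀ {x u v} (p : Walk G x v) → Shortest G p → OnWalk G u p →
    x ≡ u ⊎ (∃ λ y → y ~ u × Σ (Walk G u v) λ q → ∀ (q′ : Walk G y v) → suc (len G q) ≤ len G q′)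
  before (stay _)   _ refl        = inj₁ refl
  before (step e p) _ (inj₁ refl) = inj₁ refl
  before (step e p) short (inj₂ on) with before p (λ q → ≤-pred (short (step e q))) on
  ... | inj₂ found = inj₂ found
  ... | inj₁ refl  = inj₂ (_ , e , p , short)

  extremal : ∀ {u v} →
    (∀ {y} → y ~ u → (p : Walk G u v) → Σ (Walk G y v) λ q → len G q ≤ len G p) → Extremal u v
  extremal closer (p , short , on) with before p short on
  ... | inj₁ x≡u = x≡u
  ... | inj₂ (y , y~u , q , far) with closer y~u q
  ...   | q′ , le = contradiction (≤-trans (far q′) le) (<-irrefl refl)

  -- Leaves, bare and bushy vertices.

  module _ {U : Subset n} (P : Pruning U) where
    open Pruning P

    Leaf : Fin n → Set
    Leaf v = v ∉ U × (∀ w → v ~ w → w ≡ parent v)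

    leaf? : ∀ v → Dec (Leaf v)
    leaf? v = ¬? (v ∈? U) ×-dec all? λ w → T? (adj G v w) →-dec (w ≟ parent v)

    Bare : Fin n → Set
    Bare c = ∀ w → c ~ w → w ∈ U

    Bushy : Fin n → Set
    Bushy c = ∃ λ w → c ~ w × w ∉ U

    bushy? : ∀ c → Dec (Bushy c)
    bushy? c = any? λ w → T? (adj G c w) ×-dec ¬? (w ∈? U)

    ¬bushy⇒bare : ∀ {c} → ¬ Bushy c → Bare c
    ¬bushy⇒bare none w c~w = decidable-stable (w ∈? U) (λ w∉U → none (w , c~w , w∉U))

    leaf-or-child : ∀ {v} → v ∉ U → Leaf v ⊎ ∃ λ w → v ~ w × w ∉ U × parent w ≡ v
    leaf-or-child {v} v∉U with any? (λ w → T? (adj G v w) ×-dec ¬? (w ≟ parent v))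
    ... | no none = inj₁ (v∉U , λ w v~w → decidable-stable (w ≟ parent v) (λ w≢ → none (w , v~w , w≢)))
    ... | yes (w , v~w , w≢) with neighbour v∉U v~w
    ...   | inj₁ w≡ = contradiction w≡ w≢
    ...   | inj₂ child = inj₂ (w , v~w , child)

    leafBelow : ∀ {v} → v ∉ U → ∃ λ l → Leaf l × root l ≡ root v
    leafBelow {v} v∉U = go v∉U (<-wellFounded (rank v))
      where
      go : ∀ {v} → v ∉ U → Acc _<_ (rank v) → ∃ λ l → Leaf l × root l ≡ root v
      go {v} v∉U (acc rec) with leaf-or-child v∉U
      ... | inj₁ leaf = v , leaf , refl
      ... | inj₂ (w , _ , w∉U , refl) with go w∉U (rec (rank-parent w∉U))
      ...   | l , leaf , eq = l , leaf , trans eq (sym (root-parent w∉U))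

    root-hanging : ∀ {c w} → c ∈ U → w ∉ U → c ~ w → root w ≡ c
    root-hanging c∈U w∉U c~w =
      trans (sym (root-parent w∉U)) (trans (cong root (neighbour-core c∈U w∉U c~w)) (root-core c∈U))

    bushy⇒leaf : ∀ {c} → c ∈ U → Bushy c → ∃ λ l → Leaf l × root l ≡ c
    bushy⇒leaf c∈U (w , c~w , w∉U) with leafBelow w∉U
    ... | l , leaf , eq = l , leaf , trans eq (root-hanging c∈U w∉U c~w)

    -- On the way up from the leaf, the last vertex before the core is a neighbour of the root
    -- outside `U`.
    leaf⇒bushy : ∀ {l} → Leaf l → Bushy (root l)
    leaf⇒bushy {l} (l∉U , _) = go l∉U (<-wellFounded _)
      where
      go : ∀ {v} → v ∉ U → Acc _<_ (height ∸ rank v) → Bushy (root v)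
      go {v} v∉U (acc rec) with parent v ∈? U
      ... | yes p∈U = v , subst (_~ v) (trans (sym (root-core p∈U)) (root-parent v∉U)) (~-sym (parent-adj v∉U)) , v∉U
      ... | no  p∉U = subst Bushy (root-parent v∉U) (go p∉U (rec (∸-monoʳ-< (rank-parent v∉U) (rank≤height _))))

    -- A walk from `l` to another vertex first visits its only neighbour, so deleting the first edge
    -- leaves a shorter walk from there.
    leaf-extremal : ∀ {l v} → Leaf l → l ≢ v → Extremal l v
    leaf-extremal {l} {v} (_ , only) l≢v = extremal closer
      where
      closer : ∀ {y} → y ~ l → (p : Walk G l v) → Σ (Walk G y v) λ q → len G q ≤ len G p
      closer y~l (stay _) = contradiction refl l≢v
      closer y~l (step l~z p) rewrite only _ (~-sym y~l) | only _ l~z = p , n≤1+n _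

    -- Walks across the cycle.

    module _ {k : ℕ} {γ : ℕ → Fin n} (C : Cycle U k γ) where
      open Cycle C

      walkDown : ∀ i → Σ (Walk G (γ i) (γ 0)) λ p → len G p ≡ i
      walkDown zero    = stay (γ 0) , refl
      walkDown (suc i) with walkDown i
      ... | p , eq = step (~-sym (edge i)) p , cong suc eq

      walkUp : ∀ i d → i + d ≡ k → Σ (Walk G (γ i) (γ 0)) λ p → len G p ≡ d
      walkUp i zero    eq rewrite +-identityʳ i | eq | periodic 0 = stay (γ 0) , refl
      walkUp i (suc d) eq with walkUp (suc i) d (trans (sym (+-suc i d)) eq)
      ... | p , len≡ = step (edge i) p , cong suc len≡

      -- Along a walk the root moves by at most one step on the cycle, and the walk has to
      -- reach the cycle vertex γ 0 before it enters the tree containing its endpoint.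
      walk-through-root : ∀ {v} → root v ≡ γ 0 → ∀ {x} (p : Walk G x v) a → a ≤ k → root x ≡ γ a →
        x ∈ U ⊎ (0 < a × a < k) →
        Σ (Walk G (γ 0) v) λ q → a + len G q ≤ len G p ⊎ k + len G q ≤ a + len G p
      -- The two alternatives are arrival at index 0 and arrival at index `k`; the second bound is
      -- written without `k ∸ a`.
      walk-through-root {v} rv {x} p zero    a≤k ra h = from0 h
        where
        from0 : x ∈ U ⊎ (0 < 0 × 0 < k) → Σ (Walk G (γ 0) v) λ q → len G q ≤ len G p ⊎ k + len G q ≤ len G p
        from0 (inj₁ x∈U) rewrite trans (sym ra) (root-core x∈U) = p , inj₁ ≤-refl
      walk-through-root {v} rv {x} p (suc a) a≤k ra h with m≤n⇒m<n∨m≡n a≤k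
      ... | inj₂ refl = fromk h
        where
        fromk : x ∈ U ⊎ (0 < k × k < k) → Σ (Walk G (γ 0) v) λ q → k + len G q ≤ len G p ⊎ k + len G q ≤ k + len G p
        fromk (inj₂ (_ , k<k)) = contradiction k<k (<-irrefl refl)
        fromk (inj₁ x∈U) rewrite trans (sym (periodic 0)) (trans (sym ra) (root-core x∈U)) = p , inj₂ ≤-refl
      walk-through-root rv (stay _) (suc a) a≤k ra h | inj₁ a<k =
        contradiction (trans (sym ra) rv) (γ≢γ0 (s≤s z≤n) a<k)
      walk-through-root rv (step x~y p) (suc a) a≤k ra h | inj₁ a<k with root-edge x~y
      ... | inj₁ same with walk-through-root rv p (suc a) a≤k (trans (sym same) ra) (inj₂ (s≤s z≤n , a<k))
      ...   | q , inj₁ le = q , inj₁ (m≤n⇒m≤1+n le)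
      ...   | q , inj₂ le = q , inj₂ (≤-trans le (+-monoʳ-≤ (suc a) (n≤1+n _)))
      walk-through-root rv (step x~y p) (suc a) a≤k ra h | inj₁ a<k | inj₂ (x∈U , y∈U)
        with around a y∈U (subst (_~ _) (trans (sym (root-core x∈U)) ra) x~y)
      ... | inj₁ y≡ with walk-through-root rv p a (<⇒≤ a≤k) (trans (root-core y∈U) y≡) (inj₁ y∈U)
      ...   | q , inj₁ le = q , inj₁ (s≤s le)
      ...   | q , inj₂ le = q , inj₂ (≤-trans le (+-mono-≤ (n≤1+n a) (n≤1+n _)))
      walk-through-root rv (step x~y p) (suc a) a≤k ra h | inj₁ a<k | inj₂ (x∈U , y∈U)
          | inj₂ y≡ with walk-through-root rv p (suc (suc a)) a<k (trans (root-core y∈U) y≡) (inj₁ y∈U)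
      ...   | q , inj₁ le = q , inj₁ (m≤n⇒m≤1+n (≤-trans (n≤1+n _) le))
      ...   | q , inj₂ le = q , inj₂ (≤-trans le (≤-reflexive (sym (+-suc (suc a) _))))

      -- The two inequalities say that γ j is an antipode of γ 0; there are two such j if k is odd.
      bare-extremal : ∀ {v} j → k ≤ suc (j + j) → j + j ≤ suc k → Bare (γ j) → root v ≡ γ 0 → Extremal (γ j) v
      bare-extremal zero k≤ _ _ _ = contradiction (≤-trans 3≤k k≤) λ { (s≤s ()) }
      bare-extremal {v} (suc i) k≤ ≤k bare rv = extremal closer
        where
        j = suc i
        j<k : suc j ≤ k
        j<k = ≰⇒> λ k≤j → <-irrefl refl (begin-strict
          3 + k         ≤⟨ +-monoˡ-≤ k 3≤k ⟩
          k + k         ≤⟨ +-mono-≤ k≤j k≤j ⟩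
          j + j         ≤⟨ ≤k ⟩
          suc k         <⟨ s≤s (n<1+n k) ⟩
          2 + k         <⟨ n<1+n _ ⟩
          3 + k         ∎)
          where open ≤-Reasoning
        d = k ∸ suc j
        k≡ : suc j + d ≡ k
        k≡ = m+[n∸m]≡n j<k
        -- The neighbours of a bare `γ j` are `γ i` and `γ (suc j)`. Their arcs to `γ 0`, of lengths
        -- `i` and `d`, are at most as long as either arc from `γ j`, and `q` is appended to them.
        closer : ∀ {y} → y ~ γ j → (p : Walk G (γ j) v) → Σ (Walk G y v) λ q → len G q ≤ len G p
        closer y~ p with walk-through-root rv p j (<⇒≤ j<k) (root-core (γ∈U j)) (inj₁ (γ∈U j))
                       | around i (bare _ (~-sym y~)) (~-sym y~)
        ... | q , bound | inj₁ refl with walkDown i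
        ...   | r , r≡ = r ++ʷ q , subst (_≤ len G p) (sym (trans (len-++ʷ r q) (cong (_+ len G q) r≡))) (shorter bound)
          where
          shorter : j + len G q ≤ len G p ⊎ k + len G q ≤ j + len G p → i + len G q ≤ len G p
          shorter (inj₁ le) = ≤-trans (n≤1+n _) le
          shorter (inj₂ le) = +-cancelˡ-≤ j (i + len G q) (len G p) (begin
            j + (i + len G q)   ≡⟨ +-assoc j i (len G q) ⟨
            j + i + len G q     ≤⟨ +-monoˡ-≤ (len G q) (≤-pred (≤-trans (≤-reflexive (sym (+-suc j i))) ≤k)) ⟩
            k + len G q         ≤⟨ le ⟩
            j + len G p         ∎)
            where open ≤-Reasoning
        closer y~ p | q , bound | inj₂ refl with walkUp (suc j) d k≡
        ...   | r , r≡ = r ++ʷ q , subst (_≤ len G p) (sym (trans (len-++ʷ r q) (cong (_+ len G q) r≡))) (shorter bound)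
          where
          d≤j : d ≤ j
          d≤j = +-cancelˡ-≤ (suc j) d j (≤-trans (≤-reflexive k≡) k≤)
          shorter : j + len G q ≤ len G p ⊎ k + len G q ≤ j + len G p → d + len G q ≤ len G p
          shorter (inj₁ le) = ≤-trans (+-monoˡ-≤ (len G q) d≤j) le
          shorter (inj₂ le) = +-cancelˡ-≤ j (d + len G q) (len G p) (begin
            j + (d + len G q)   ≡⟨ +-assoc j d (len G q) ⟨
            j + d + len G q     ≤⟨ +-monoˡ-≤ (len G q) (≤-trans (n≤1+n _) (≤-reflexive k≡)) ⟩
            k + len G q         ≤⟨ le ⟩
            j + len G p         ∎)
            where open ≤-Reasoning

    -- Pairs that meet every strong resolving set.

    module _ {k : ℕ} {γ : ℕ → Fin n} (C : Cycle U k γ) {W : Subset n} (res : StrongResolvingSet G W) where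
      open Cycle C

      two-leaves : ∀ {l l′} → Leaf l → Leaf l′ → l ≢ l′ → l ∈ W ⊎ l′ ∈ W
      two-leaves leaf leaf′ l≢l′ = extremal-pair res l≢l′ (leaf-extremal leaf l≢l′) (leaf-extremal leaf′ (l≢l′ ∘ sym))

      bare-leaf : ∀ {l} j → k ≤ suc (j + j) → j + j ≤ suc k → Bare (γ j) → Leaf l → root l ≡ γ 0 → γ j ∈ W ⊎ l ∈ W
      bare-leaf {l} j k≤ ≤k bare leaf rl =
        extremal-pair res (l≢ ∘ sym) (bare-extremal C j k≤ ≤k bare rl) (leaf-extremal leaf l≢)
        where
        l≢ : l ≢ γ j
        l≢ refl = proj₁ leaf (γ∈U j)

      -- Being an antipode is symmetric: counted from `γ j`, the vertex `γ 0` has index `k ∸ j`,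
      -- which satisfies the same two inequalities.
      bare-bare : ∀ j → k ≤ suc (j + j) → j + j ≤ suc k → 0 < j → j < k → Bare (γ j) → Bare (γ 0) → γ j ∈ W ⊎ γ 0 ∈ W
      bare-bare j k≤ ≤k 0<j j<k bare bare0 =
        extremal-pair res (γ≢γ0 0<j j<k)
          (bare-extremal C j k≤ ≤k bare (root-core (γ∈U 0)))
          (subst (λ u → Extremal u (γ j)) back (bare-extremal (shift j C) d k≤′ ≤k′ (subst Bare (sym back) bare0)
             (trans (root-core (γ∈U j)) (cong γ (sym (+-identityʳ j))))))
        where
        open ≤-Reasoning
        d = k ∸ j
        j+d : j + d ≡ k
        j+d = m+[n∸m]≡n (<⇒≤ j<k)
        back : γ (j + d) ≡ γ 0
        back = trans (cong γ j+d) (periodic 0)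
        k≤′ : k ≤ suc (d + d)
        k≤′ = +-cancelˡ-≤ j k (suc (d + d)) (begin
          j + k             ≡⟨ cong (j +_) j+d ⟨
          j + (j + d)       ≡⟨ +-assoc j j d ⟨
          j + j + d         ≤⟨ +-monoˡ-≤ d ≤k ⟩
          suc (k + d)       ≡⟨ cong (λ z → suc (z + d)) j+d ⟨
          suc (j + d + d)   ≡⟨ cong suc (+-assoc j d d) ⟩
          suc (j + (d + d)) ≡⟨ +-suc j (d + d) ⟨
          j + suc (d + d)   ∎)
        ≤k′ : d + d ≤ suc k
        ≤k′ = +-cancelˡ-≤ j (d + d) (suc k) (begin
          j + (d + d)       ≡⟨ +-assoc j d d ⟨
          j + d + d         ≡⟨ cong (_+ d) j+d ⟩
          k + d             ≤⟨ +-monoˡ-≤ d k≤ ⟩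
          suc (j + j + d)   ≡⟨ cong suc (trans (+-assoc j j d) (cong (j +_) j+d)) ⟩
          suc (j + k)       ≡⟨ +-suc j k ⟨
          j + suc k         ∎)

  -- Ancestors and forcing.

  module _ {U : Subset n} (P : Pruning U) where
    open Pruning P

    infix 4 _⇡_
    -- `v` is `u` or one of its ancestors, up to and including the root in the core.
    data _⇡_ : Fin n → Fin n → Set where
      here : ∀ {v} → v ⇡ v
      up   : ∀ {u v} → u ∉ U → parent u ⇡ v → u ⇡ v

    _⇡?_ : ∀ u v → Dec (u ⇡ v)
    u ⇡? v = go u (<-wellFounded _)
      where
      go : ∀ u → Acc _<_ (height ∸ rank u) → Dec (u ⇡ v)
      go u (acc rec) with u ≟ v
      ... | yes refl = yes here
      ... | no u≢v with u ∈? U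
      ...   | yes u∈U = no λ { here → u≢v refl ; (up u∉U _) → u∉U u∈U }
      ...   | no  u∉U with go (parent u) (rec (∸-monoʳ-< (rank-parent u∉U) (rank≤height _)))
      ...     | yes p = yes (up u∉U p)
      ...     | no ¬p = no λ { here → u≢v refl ; (up _ p) → ¬p p }

    ⇡-parent : ∀ {u v} → u ⇡ v → v ∉ U → u ⇡ parent v
    ⇡-parent here       v∉U = up v∉U here
    ⇡-parent (up u∉U p) v∉U = up u∉U (⇡-parent p v∉U)

    ⇡-root : ∀ {u v} → u ⇡ v → root u ≡ root v
    ⇡-root here       = refl
    ⇡-root (up u∉U p) = trans (sym (root-parent u∉U)) (⇡-root p)

    ⇡-rank : ∀ {u v} → u ⇡ v → rank u ≤ rank v
    ⇡-rank here       = ≤-refl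
    ⇡-rank (up u∉U p) = ≤-trans (<⇒≤ (rank-parent u∉U)) (⇡-rank p)

    ⇡-comparable : ∀ {u v w} → u ⇡ v → u ⇡ w → v ⇡ w ⊎ w ⇡ v
    ⇡-comparable here     q        = inj₁ q
    ⇡-comparable p        here     = inj₂ p
    ⇡-comparable (up _ p) (up _ q) = ⇡-comparable p q

    -- Otherwise `w` would be an ancestor of its own parent, against the ranks.
    ⇡-sibling : ∀ {v w} → w ∉ U → parent v ≡ parent w → v ⇡ w → v ≡ w
    ⇡-sibling w∉U _  here     = refl
    ⇡-sibling w∉U eq (up _ p) = contradiction
      (≤-trans (rank-parent w∉U) (subst (λ z → rank z ≤ _) eq (⇡-rank p))) (<-irrefl refl)

    ⇡-child-unique : ∀ {u v w} → v ∉ U → w ∉ U → parent v ≡ parent w → u ⇡ v → u ⇡ w → v ≡ w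
    ⇡-child-unique v∉U w∉U eq p q with ⇡-comparable p q
    ... | inj₁ r = ⇡-sibling w∉U eq r
    ... | inj₂ r = sym (⇡-sibling v∉U (sym eq) r)

    -- ℓ need not be a leaf: a core vertex ℓ expresses that S contains all leaves.
    module Forcing (S : Subset n) (ℓ : Fin n) (leaves : ∀ {l} → Leaf P l → l ≢ ℓ → l ∈ S) where

      mutual
        -- Induction from the leaves upwards: leaves other than `ℓ` are in `S`, and any other vertex
        -- is forced by a child once that child and its own children are black.
        climb : ∀ {v} → v ∉ U → ¬ ℓ ⇡ v → Acc _<_ (rank v) → Black G S v
        climb v∉U ¬ℓv (acc rec) with leaf-or-child P v∉U
        ... | inj₁ leaf = initial (leaves leaf λ { refl → ¬ℓv here })
        ... | inj₂ (w , _ , w∉U , refl) =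
          force-parent w∉U (λ p → ¬ℓv (⇡-parent p w∉U)) (rec (rank-parent w∉U))

        force-parent : ∀ {v} → v ∉ U → ¬ ℓ ⇡ v → Acc _<_ (rank v) → Black G S (parent v)
        force-parent {v} v∉U ¬ℓv a@(acc rec) = force (climb v∉U ¬ℓv a) (parent-adj v∉U) others
          where
          others : ∀ w → v ~ w → w ≢ parent v → Black G S w
          others w v~w w≢ with neighbour v∉U v~w
          ... | inj₁ w≡           = contradiction w≡ w≢
          ... | inj₂ (w∉U , refl) = climb w∉U (λ p → ¬ℓv (⇡-parent p w∉U)) (rec (rank-parent w∉U))

      black-off-path : ∀ {v} → v ∉ U → ¬ ℓ ⇡ v → Black G S v
      black-off-path v∉U ¬ℓv = climb v∉U ¬ℓv (<-wellFounded _)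

      hanging-off-path : ∀ {c w} → c ∈ U → c ≢ root ℓ → c ~ w → w ∉ U → ¬ ℓ ⇡ w
      hanging-off-path c∈U c≢ c~w w∉U p = c≢ (trans (sym (root-hanging P c∈U w∉U c~w)) (sym (⇡-root p)))

      -- `ℓ` lies in no tree hanging from `c`, so the top vertex of such a tree forces `c`.
      bushy-black : ∀ {c} → c ∈ U → Bushy P c → c ≢ root ℓ → Black G S c
      bushy-black c∈U (w , c~w , w∉U) c≢ =
        subst (Black G S) (neighbour-core c∈U w∉U c~w)
          (force-parent w∉U (hanging-off-path c∈U c≢ c~w w∉U) (<-wellFounded _))

      -- Blackness descends the path to `ℓ`: the neighbours of `parent v` other than `v` are in the
      -- core, off the path, or the path vertex just above.
      black-on-path : (∀ {c} → c ∈ U → Black G S c) → ∀ {v} → ℓ ⇡ v → Black G S v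
      black-on-path core p = go p (<-wellFounded _)
        where
        go : ∀ {v} → ℓ ⇡ v → Acc _<_ (height ∸ rank v) → Black G S v
        go {v} p (acc rec) with v ∈? U
        ... | yes v∈U = core v∈U
        ... | no  v∉U = force (go p′ (rec (closer v∉U))) (~-sym (parent-adj v∉U)) others
          where
          p′ : ℓ ⇡ parent v
          p′ = ⇡-parent p v∉U
          closer : ∀ {x} → x ∉ U → height ∸ rank (parent x) < height ∸ rank x
          closer x∉U = ∸-monoʳ-< (rank-parent x∉U) (rank≤height _)
          others : ∀ w → parent v ~ w → w ≢ v → Black G S w
          others w pv~w w≢v with w ∈? U
          ... | yes w∈U = core w∈U
          ... | no  w∉U with neighbour w∉U (~-sym pv~w)
          ...   | inj₁ same          = black-off-path w∉U λ q → w≢v (sym (⇡-child-unique v∉U w∉U same p q))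
          ...   | inj₂ (pv∉U , refl) = go (⇡-parent p′ pv∉U) (rec (<-trans (closer pv∉U) (closer v∉U)))

      module _ {k : ℕ} {γ : ℕ → Fin n} (C : Cycle U k γ) where
        open Cycle C

        private
          -- `γ (suc i)` is not the root of `ℓ`, so the tree vertices next to it are black and only
          -- its successor on the cycle can be white.
          forward : ∀ i → γ (suc i) ≢ root ℓ → Black G S (γ i) → Black G S (γ (suc i)) → Black G S (γ (suc (suc i)))
          forward i ≢r b b′ = force b′ (edge (suc i)) others
            where
            others : ∀ w → γ (suc i) ~ w → w ≢ γ (suc (suc i)) → Black G S w
            others w ~w w≢ with w ∈? U
            ... | no  w∉U = black-off-path w∉U (hanging-off-path (γ∈U _) ≢r ~w w∉U)
            ... | yes w∈U with around i w∈U ~w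
            ...   | inj₁ refl = b
            ...   | inj₂ w≡   = contradiction w≡ w≢

          backward : ∀ i → γ (suc i) ≢ root ℓ → Black G S (γ (suc i)) → Black G S (γ (suc (suc i))) → Black G S (γ i)
          backward i ≢r b b′ = force b (~-sym (edge i)) others
            where
            others : ∀ w → γ (suc i) ~ w → w ≢ γ i → Black G S w
            others w ~w w≢ with w ∈? U
            ... | no  w∉U = black-off-path w∉U (hanging-off-path (γ∈U _) ≢r ~w w∉U)
            ... | yes w∈U with around i w∈U ~w
            ...   | inj₁ w≡   = contradiction w≡ w≢
            ...   | inj₂ refl = b′

          -- The index is taken in `1 … k`, so that the ascent from 0 and the descent from `k` both
          -- end at `j`.
          root-index : ∃ λ j → 0 < j × j ≤ k × γ j ≡ root ℓ
          root-index with cover (root∈U ℓ)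
          ... | suc j , j<k , eq = suc j , s≤s z≤n , <⇒≤ j<k , eq
          ... | zero  , _   , eq = k , 0<k , ≤-refl , trans (periodic 0) eq

        two-adjacent⇒forcing : Black G S (γ 0) → Black G S (γ 1) → ZeroForcingSet G S
        two-adjacent⇒forcing b0 b1 v with root-index
        ... | j , 0<j , j≤k , γj≡ = all v
          where
          ascend : ∀ i → suc i ≤ j → Black G S (γ i) × Black G S (γ (suc i))
          ascend zero    _   = b0 , b1
          ascend (suc i) i<j with ascend i (<⇒≤ i<j)
          ... | b , b′ = b′ , forward i (λ eq → distinct (s≤s z≤n) i<j j≤k (trans eq (sym γj≡))) b b′
          -- The descent starts from `γ k` and `γ (suc k)`, which are `γ 0` and `γ 1`.
          descend : ∀ d i → i + d ≡ k → j ≤ i → Black G S (γ i) × Black G S (γ (suc i))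
          descend zero i eq _ rewrite +-identityʳ i | eq =
            subst (Black G S) (sym (periodic 0)) b0 , subst (Black G S) (sym (periodic 1)) b1
          descend (suc d) i eq j≤i with descend d (suc i) (trans (sym (+-suc i d)) eq) (m≤n⇒m≤1+n j≤i)
          ... | b , b′ = backward i (λ eq′ → distinct 0<j (s≤s j≤i) i<k (sym (trans eq′ (sym γj≡)))) b b′ , b
            where
            i<k : suc i ≤ k
            i<k = ≤-trans (m≤m+n (suc i) d) (≤-reflexive (trans (sym (+-suc i d)) eq))
          core : ∀ {c} → c ∈ U → Black G S c
          core c∈U with cover c∈U
          ... | i , i<k , refl with <-≤-connex i j
          ...   | inj₁ i<j = proj₁ (ascend i i<j)
          ...   | inj₂ j≤i = proj₁ (descend (k ∸ i) i (m+[n∸m]≡n (<⇒≤ i<k)) j≤i)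
          all : ∀ v → Black G S v
          all v with v ∈? U
          ... | yes v∈U = core v∈U
          ... | no  v∉U with ℓ ⇡? v
          ...   | yes p = black-on-path core p
          ...   | no ¬p = black-off-path v∉U ¬p

  -- Construction of the zero forcing set.

  module _ {U : Subset n} (P : Pruning U) {W : Subset n} (res : StrongResolvingSet G W) where
    open Pruning P

    private
      Goal : Set
      Goal = ∃ λ S → ZeroForcingSet G S × ∣ S ∣ ≤ ∣ W ∣

      leaf≢core : ∀ {l c} → Leaf P l → c ∈ U → l ≢ c
      leaf≢core (l∉U , _) c∈U refl = l∉U c∈U

    -- Only γ 0 may carry a tree, so γ 1 and its antipode are bare and W contains one of them.
    one-bushy : ∀ {k γ} → Cycle U k γ → (∀ {l} → Leaf P l → l ∈ W) →
      (∀ i → 0 < i → i < k → Bare P (γ i)) → γ 0 ∈ W ⊎ Bushy P (γ 0) → Goal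
    one-bushy {k} {γ} C leaves⊆W bare base with half k
    ... | m , h = cases (bare-bare P (shift 1 C) res m (half-upper h) (half-lower h) (half-positive 3≤k h)
                          (<-trans (n<1+n m) 1+m<k) (bare (suc m) (s≤s z≤n) 1+m<k) (bare 1 (s≤s z≤n) 1<k))
      where
      open Cycle C
      1<k : 1 < k
      1<k = ≤-trans (n≤1+n 2) 3≤k
      1+m<k : suc m < k
      1+m<k = 1+half< 3≤k h

      replace : ∀ j → 0 < j → j < k → γ j ∈ W → Goal
      replace j 0<j j<k γj∈W =
        S , two-adjacent⇒forcing C (start base) (initial (x∈exchange W γj∈W (γ 1))) , ∣exchange∣ W γj∈W (γ 1)
        where
        S : Subset n
        S = exchange W γj∈W (γ 1)
        -- The exempt vertex is the core vertex `γ 1`: no leaf is exempted, and `bushy-black` still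
        -- applies to `γ 0`.
        open Forcing P S (γ 1) (λ leaf _ → ∈exchange W γj∈W (γ 1) (leaves⊆W leaf) (leaf≢core leaf (γ∈U j)))
        start : γ 0 ∈ W ⊎ Bushy P (γ 0) → Black G S (γ 0)
        start (inj₁ γ0∈W)  = initial (∈exchange W γj∈W (γ 1) γ0∈W (γ≢γ0 0<j j<k ∘ sym))
        start (inj₂ bushy) =
          bushy-black (γ∈U 0) bushy λ eq → γ≢γ0 (s≤s z≤n) 1<k (sym (trans eq (root-core (γ∈U 1))))

      cases : γ (suc m) ∈ W ⊎ γ 1 ∈ W → Goal
      cases (inj₁ ∈W) = replace (suc m) (s≤s z≤n) 1+m<k ∈W
      -- Here `γ 1` is exchanged for itself.
      cases (inj₂ ∈W) = replace 1 (s≤s z≤n) 1<k ∈W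

    -- With no bushy vertex, an antipodal bare pair puts a core vertex into `W` to start from; with
    -- exactly one, that one is the start; with two, a leaf of the second is traded for `γ′ 1` while
    -- the first still turns black.
    all-leaves : ∀ {k γ} → Cycle U k γ → (∀ {l} → Leaf P l → l ∈ W) → Goal
    all-leaves {k} {γ} C leaves⊆W with any? (λ c → (c ∈? U) ×-dec bushy? P c)
    ... | no none with half k
    ...   | m , h = cases (bare-bare P C res m (half-upper h) (half-lower h) (half-positive 3≤k h)
                            (<-trans (n<1+n m) (1+half< 3≤k h)) (bare (γ∈U m)) (bare (γ∈U 0)))
      where
      open Cycle C
      bare : ∀ {c} → c ∈ U → Bare P c
      bare c∈U = ¬bushy⇒bare P λ b → none (_ , c∈U , b)
      from : ∀ {c} → c ∈ U → c ∈ W → Goal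
      from c∈U c∈W with rebase C c∈U
      ... | γ′ , C′ , refl = one-bushy C′ leaves⊆W (λ i _ _ → bare (Cycle.γ∈U C′ i)) (inj₁ c∈W)
      cases : γ m ∈ W ⊎ γ 0 ∈ W → Goal
      cases (inj₁ ∈W) = from (γ∈U m) ∈W
      cases (inj₂ ∈W) = from (γ∈U 0) ∈W
    all-leaves C leaves⊆W | yes (c , c∈U , bushy) with rebase C c∈U
    ...   | γ′ , C′ , refl = two (any? (λ d → (d ∈? U) ×-dec ¬? (d ≟ γ′ 0) ×-dec bushy? P d))
      where
      open Cycle C′
      two : Dec (∃ λ d → d ∈ U × (¬ (d ≡ γ′ 0)) × Bushy P d) → Goal
      two (no none) = one-bushy C′ leaves⊆W
        (λ i 0<i i<k → ¬bushy⇒bare P λ b → none (γ′ i , γ∈U i , γ≢γ0 0<i i<k , b)) (inj₂ bushy)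
      two (yes (d , d∈U , d≢ , bushy-d)) with bushy⇒leaf P d∈U bushy-d
      ... | l , leaf , refl =
        S , two-adjacent⇒forcing C′ (bushy-black (γ∈U 0) bushy (d≢ ∘ sym)) (initial (x∈exchange W l∈W (γ′ 1))) ,
        ∣exchange∣ W l∈W (γ′ 1)
        where
        l∈W : l ∈ W
        l∈W = leaves⊆W leaf
        S : Subset n
        S = exchange W l∈W (γ′ 1)
        open Forcing P S l (λ leaf′ l≢ → ∈exchange W l∈W (γ′ 1) (leaves⊆W leaf′) l≢)

    -- Every leaf but `ℓ` is in `W`, and so is `γ m` unless it is bushy. What remains is to secure
    -- its neighbour `γ (suc m)`, or else another adjacent pair.
    missing-leaf : ∀ {k γ ℓ} → Cycle U k γ → Leaf P ℓ → ℓ ∉ W → root ℓ ≡ γ 0 → Goal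
    missing-leaf {k} {γ} {ℓ} C leaf ℓ∉W rℓ with half k
    ... | m , h = cases h
      where
      open Cycle C
      0<m : 0 < m
      0<m = half-positive 3≤k h
      1+m<k : suc m < k
      1+m<k = 1+half< 3≤k h
      m<k : m < k
      m<k = <-trans (n<1+n m) 1+m<k

      others∈W : ∀ {l} → Leaf P l → l ≢ ℓ → l ∈ W
      others∈W leaf′ l≢ℓ with two-leaves P C res leaf′ leaf l≢ℓ
      ... | inj₁ ∈W = ∈W
      ... | inj₂ ∈W = contradiction ∈W ℓ∉W

      antipode∈W : ∀ j → k ≤ suc (j + j) → j + j ≤ suc k → Bare P (γ j) → γ j ∈ W
      antipode∈W j k≤ ≤k bare with bare-leaf P C res j k≤ ≤k bare leaf rℓ
      ... | inj₁ ∈W = ∈W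
      ... | inj₂ ∈W = contradiction ∈W ℓ∉W

      module _ (S : Subset n) (leaves : ∀ {l} → Leaf P l → l ≢ ℓ → l ∈ S) where
        open Forcing P S ℓ leaves

        black-γ : ∀ j → 0 < j → j < k → (Bare P (γ j) → γ j ∈ S) → Black G S (γ j)
        black-γ j 0<j j<k bare⇒∈ with bushy? P (γ j)
        ... | yes bushy  = bushy-black (γ∈U j) bushy λ eq → γ≢γ0 0<j j<k (trans eq rℓ)
        ... | no  ¬bushy = initial (bare⇒∈ (¬bushy⇒bare P ¬bushy))

        finish : (Bare P (γ m) → γ m ∈ S) → (Bare P (γ (suc m)) → γ (suc m) ∈ S) → ZeroForcingSet G S
        finish bm bm′ = two-adjacent⇒forcing (shift m C)
          (subst (λ i → Black G S (γ i)) (sym (+-identityʳ m)) (black-γ m 0<m m<k bm))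
          (subst (λ i → Black G S (γ i)) (sym (+-comm m 1)) (black-γ (suc m) (s≤s z≤n) 1+m<k bm′))

      antipode∈W-m : Bare P (γ m) → γ m ∈ W
      antipode∈W-m = antipode∈W m (half-upper h) (half-lower h)

      -- Here γ 0 and γ 1 both carry trees: put ℓ back and drop an element of W over γ m instead.
      module _ (1<m : 1 < m) (bushy₁ : Bushy P (γ 1)) where

        drop : ∀ {y} → y ∈ W → root y ≡ γ m → Goal
        drop {y} y∈W ry = S , two-adjacent⇒forcing C
            -- Both vertices are bushy and, as `1 < m`, differ from `γ m`, the root of the exempt
            -- vertex `y`.
            (bushy-black (γ∈U 0) (subst (Bushy P) rℓ (leaf⇒bushy P leaf)) λ eq → γ≢γ0 0<m m<k (sym (trans eq ry)))
            (bushy-black (γ∈U 1) bushy₁ λ eq → distinct (s≤s z≤n) 1<m (<⇒≤ m<k) (trans eq ry)) ,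
          ∣exchange∣ W y∈W ℓ
          where
          S : Subset n
          S = exchange W y∈W ℓ
          leaves : ∀ {l} → Leaf P l → l ≢ y → l ∈ S
          leaves {l} leaf′ l≢y with l ≟ ℓ
          ... | yes refl = x∈exchange W y∈W ℓ
          ... | no  l≢ℓ  = ∈exchange W y∈W ℓ (others∈W leaf′ l≢ℓ) l≢y
          open Forcing P S y leaves

        bushy-next : Goal
        bushy-next with bushy? P (γ m)
        ... | no ¬bushy = drop (antipode∈W-m (¬bushy⇒bare P ¬bushy)) (root-core (γ∈U m))
        ... | yes bushy with bushy⇒leaf P (γ∈U m) bushy
        ...   | l , leaf′ , rl =
          drop (others∈W leaf′ λ { refl → γ≢γ0 0<m m<k (trans (sym rl) rℓ) }) rl

      keep : (Bare P (γ (suc m)) → γ (suc m) ∈ W) → Goal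
      keep bm′ = W , finish W others∈W antipode∈W-m bm′ , ≤-refl

      cases : Half k m → Goal
      -- For `k = 2m + 1` the index `m + 1` is an antipode as well.
      cases (odd refl) = keep (antipode∈W (suc m)
        (s≤s (≤-trans (n≤1+n _) (s≤s (+-monoʳ-≤ m (n≤1+n m)))))
        (≤-reflexive (cong suc (+-suc m m))))
      cases (even refl) with bushy? P (γ 1)
      ... | yes bushy₁ = bushy-next (half-even 3≤k) bushy₁
      ... | no ¬bushy₁ with bushy? P (γ (suc m))
      ...   | yes bushy = keep λ bare → contradiction (bare _ (proj₁ (proj₂ bushy))) (proj₂ (proj₂ bushy))
      -- `γ 1` and `γ (suc m)` are bare and antipodal; if `W` is only known to contain `γ 1`, it is
      -- exchanged for `γ (suc m)`.
      ...   | no ¬bushy with bare-bare P (shift 1 C) res m (half-upper h) (half-lower h) 0<m m<k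
                               (¬bushy⇒bare P ¬bushy) (¬bushy⇒bare P ¬bushy₁)
      ...     | inj₁ ∈W   = keep λ _ → ∈W
      ...     | inj₂ γ1∈W =
        exchange W γ1∈W (γ (suc m)) ,
        finish _ (λ leaf′ l≢ → ∈exchange W γ1∈W _ (others∈W leaf′ l≢) (leaf≢core leaf′ (γ∈U 1)))
          (λ bare → ∈exchange W γ1∈W _ (antipode∈W-m bare) (distinct (s≤s z≤n) (half-even 3≤k) (<⇒≤ m<k) ∘ sym))
          (λ _ → x∈exchange W γ1∈W _) ,
        ∣exchange∣ W γ1∈W (γ (suc m))

-- Comparing the minima amounts to matching each strong resolving set with a zero forcing set that
-- is no larger.
theorem3p11 : ∀ (n : ℕ) (G : Graph n) → Unicyclic G →
    ∀ (W : Subset n) → StrongResolvingSet G W →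
    ∃ λ (S : Subset n) → ZeroForcingSet G S × ∣ S ∣ ≤ ∣ W ∣
theorem3p11 zero    G _ W _ = W , (λ ()) , ≤-refl
theorem3p11 (suc n) G (conn , m≡n) W res with pruned G
... | U , P , noPendant with cycle G P (core-twoRegular G conn m≡n P noPendant) conn zero
...   | k , γ , C with any? (λ l → leaf? G P l ×-dec ¬? (l ∈? W))
...     | no none = all-leaves G P res C λ {l} leaf → decidable-stable (l ∈? W) (λ l∉W → none (l , leaf , l∉W))
...     | yes (l , leaf , l∉W) with rebase G C (Pruning.root∈U P l)
...       | γ′ , C′ , eq = missing-leaf G P res C′ leaf l∉W (sym eq)
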